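{- Let $q$ be a prime power, let $A, B\subseteq M_2(\mathbb{F}_q)$ and let $C\subseteq GL_2(\mathbb{F}_q)$ be nonempty. Then \[ E_+(A, B) \ll \frac{|A|^2|BC|^2}{q^4} + q^{13/2}\frac{|A||BC|}{|C|}, \] where $BC=\{bc: b\in B, c\in C\}$.
   Context: $M_2(\mathbb{F}_q)$ is the ring of $2\times 2$ matrices over the finite field $\mathbb{F}_q$ and $GL_2(\mathbb{F}_q)$ its invertible elements. For $A,B\subseteq M_2(\mathbb{F}_q)$, $E_+(A,B)$ is the number of $(a,a',b,b')\in A^2\times B^2$ with $a+b=a'+b'$. The notation $X\ll Y$ means $X\le cY$ for an absolute constant $c>0$. -}

module Defs where

open import Level using (0ℓ)
open import Data.Nat using (ℕ; _^_)
open import Data.Product using (_×_; _,_; ∃; Σ)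
open import Data.List using (List; length; filter; cartesianProduct; cartesianProductWith; deduplicate)
open import Data.List.Membership.Propositional using (_∈_)
open import Data.List.Relation.Unary.Unique.Propositional using (Unique)
open import Data.Nat.Primality using (Prime)
open import Relation.Binary.PropositionalEquality using (_≡_; _≢_; refl; cong)
open import Relation.Binary.Definitions using (DecidableEquality)
open import Relation.Nullary using (yes; no)
open import Algebra.Structures using (IsCommutativeRing)

record FiniteField : Set₁ where
  infixl 6 _+_
  infixl 7 _*_
  field
    Carrier  : Set
    _+_ _*_  : Carrier → Carrier → Carrier
    -_       : Carrier → Carrier
    0# 1#    : Carrier
    isCommutativeRing : IsCommutativeRing _≡_ _+_ _*_ -_ 0# 1#
    0≢1      : 0# ≢ 1#
    inverse  : ∀ x → x ≢ 0# → ∃ λ y → x * y ≡ 1#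
    _≟_      : DecidableEquality Carrier
    elements : List Carrier
    elements-unique   : Unique elements
    elements-complete : ∀ x → x ∈ elements

  card : ℕ
  card = length elements

module M2 (F : FiniteField) where
  open FiniteField F

  record Mat : Set where
    constructor mat
    field
      m11 m12 m21 m22 : Carrier
  open Mat public

  _+M_ : Mat → Mat → Mat
  mat a b c d +M mat a' b' c' d' = mat (a + a') (b + b') (c + c') (d + d')

  _*M_ : Mat → Mat → Mat
  mat a b c d *M mat a' b' c' d' =
    mat (a * a' + b * c') (a * b' + b * d') (c * a' + d * c') (c * b' + d * d')

  det : Mat → Carrier
  det (mat a b c d) = a * d + - (b * c)

  Invertible : Mat → Set
  Invertible m = det m ≢ 0#

  _≟M_ : DecidableEquality Mat
  mat a b c d ≟M mat a' b' c' d' with a ≟ a' | b ≟ b' | c ≟ c' | d ≟ d'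
  ... | yes refl | yes refl | yes refl | yes refl = yes refl
  ... | no p | _ | _ | _ = no λ e → p (cong m11 e)
  ... | yes _ | no p | _ | _ = no λ e → p (cong m12 e)
  ... | yes _ | yes _ | no p | _ = no λ e → p (cong m21 e)
  ... | yes _ | yes _ | yes _ | no p = no λ e → p (cong m22 e)

  -- Finite subsets of M_2(F_q) are represented by duplicate-free lists;
  -- |A| is the length of the list.

  prodSet : List Mat → List Mat → List Mat
  prodSet B C = deduplicate _≟M_ (cartesianProductWith _*M_ B C)

  E+ : List Mat → List Mat → ℕ
  E+ A B = length (filter (λ { ((a , a') , (b , b')) → (a +M b) ≟M (a' +M b') })
                          (cartesianProduct (cartesianProduct A A) (cartesianProduct B B)))

IsPrimePower : ℕ → Set
IsPrimePower q = Σ ℕ λ p → Σ ℕ λ k → Prime p × q ≡ p ^ (Data.Nat.suc k)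

{-# OPTIONS --safe #-}

-- Put D = BC and let e(c) be the number of solutions of a c + d = a′ c + d′ with a, a′ ∈ A and
-- d, d′ ∈ D.  Multiplication by c ∈ C embeds the quadruples counted by E₊(A, B) into those counted
-- by e(c), so |C| E₊(A, B) ≤ ∑_{c ∈ C} e(c).  By Cauchy–Schwarz e(c) ≥ |A|²|D|²/q⁴ for every matrix
-- c, so the excess of e over this average, summed over C, is at most its sum over all of M₂(F_q).
-- In the latter sum an invertible a - a′ admits one c, and a rank one a - a′ admits q² or none,
-- according to whether d′ - d is annihilated by the same row vector u as a - a′.  For u on the
-- projective line let α(u), δ(u) count the pairs in A, D that agree after multiplication by u.
-- Then α(u) ≤ q²|A|, q² δ(u) ≥ |D|², and a second moment over M₂(F_q) gives
-- ∑_u (q² δ(u) - |D|²) ≤ q⁴|D|.  The total excess is therefore at most 3 q⁶|A||D|, which is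
-- stronger than q^{13/2}|A||D| up to the constant.
module Submission where

open import Defs
open import Data.Nat using (ℕ; suc; _+_; _*_; _∸_; _^_; _≤_; z≤n; s≤s; NonZero; >-nonZero)
open import Data.Nat.Properties hiding (_≟_)
open import Data.Nat.Solver using (module +-*-Solver)
open import Data.Nat.Tactic.RingSolver using (solve-∀)
open import Data.Nat.ListAction using (sum)
open import Data.Nat.ListAction.Properties using (sum-++)
open import Data.Product using (∃; _×_; _,_; proj₁; proj₂)
open import Data.Product.Properties using (≡-dec)
open import Data.Sum using (inj₁; inj₂)
open import Data.List using (List; []; _∷_; length; map; filter; cartesianProduct; cartesianProductWith)
open import Data.List.Properties using (length-map; map-++; map-∘)
open import Data.List.Membership.Propositional using (_∈_)
open import Data.List.Membership.Propositional.Properties using (∈-map⁺; ∈-map⁻; ∈-cartesianProduct⁺; ∈-cartesianProductWith⁺; ∈-deduplicate⁺)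
open import Data.List.Relation.Unary.Any using (here; there)
open import Data.List.Relation.Unary.All as All using (All; []; _∷_)
open import Data.List.Relation.Unary.AllPairs using ([]; _∷_)
open import Data.List.Relation.Unary.Unique.Propositional using (Unique)
open import Data.List.Relation.Unary.Unique.Propositional.Properties using (map⁺; cartesianProduct⁺; cartesianProductWith⁺)
import Data.List.Relation.Unary.Unique.DecPropositional.Properties as DecUnique
open import Relation.Nullary using (Dec; yes; no; ¬_; contradiction)
open import Relation.Nullary.Decidable using (_×-dec_)
open import Relation.Binary.Definitions using (DecidableEquality)
open import Relation.Binary.PropositionalEquality using (_≡_; _≢_; refl; sym; trans; cong; cong₂; subst; subst₂)
open import Algebra.Bundles using (CommutativeRing)
import Algebra.Properties.Group as GroupProperties
import Algebra.Solver.Ring.NaturalCoefficients.Default as SemiringSolver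
open import Level using (0ℓ)

private variable
  X Y Z : Set
  P Q : Set

-- Finite sums of natural numbers

∑ : List X → (X → ℕ) → ℕ
∑ xs f = sum (map f xs)

infix 5 ∑
syntax ∑ xs (λ x → e) = ∑[ x ∈ xs ] e

∑-mono-∈ : ∀ (xs : List X) {f g : X → ℕ} → (∀ {x} → x ∈ xs → f x ≤ g x) → ∑ xs f ≤ ∑ xs g
∑-mono-∈ []       h = z≤n
∑-mono-∈ (x ∷ xs) h = +-mono-≤ (h (here refl)) (∑-mono-∈ xs (λ m → h (there m)))

∑-mono : ∀ (xs : List X) {f g : X → ℕ} → (∀ x → f x ≤ g x) → ∑ xs f ≤ ∑ xs g
∑-mono xs h = ∑-mono-∈ xs (λ {x} _ → h x)

∑-cong-∈ : ∀ (xs : List X) {f g : X → ℕ} → (∀ {x} → x ∈ xs → f x ≡ g x) → ∑ xs f ≡ ∑ xs g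
∑-cong-∈ []       h = refl
∑-cong-∈ (x ∷ xs) h = cong₂ _+_ (h (here refl)) (∑-cong-∈ xs (λ m → h (there m)))

∑-cong : ∀ (xs : List X) {f g : X → ℕ} → (∀ x → f x ≡ g x) → ∑ xs f ≡ ∑ xs g
∑-cong xs h = ∑-cong-∈ xs (λ {x} _ → h x)

∑-+ : ∀ (xs : List X) (f g : X → ℕ) → (∑[ x ∈ xs ] (f x + g x)) ≡ ∑ xs f + ∑ xs g
∑-+ []       f g = refl
∑-+ (x ∷ xs) f g rewrite ∑-+ xs f g = lemma (f x) (g x) (∑ xs f) (∑ xs g)
  where
  lemma : ∀ a b c d → a + b + (c + d) ≡ a + c + (b + d)
  lemma = solve-∀

∑-*ˡ : ∀ (xs : List X) k (f : X → ℕ) → (∑[ x ∈ xs ] k * f x) ≡ k * ∑ xs f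
∑-*ˡ []       k f = sym (*-zeroʳ k)
∑-*ˡ (x ∷ xs) k f rewrite ∑-*ˡ xs k f = sym (*-distribˡ-+ k (f x) (∑ xs f))

∑-*ʳ : ∀ (xs : List X) (f : X → ℕ) k → (∑[ x ∈ xs ] f x * k) ≡ ∑ xs f * k
∑-*ʳ xs f k = trans (∑-cong xs λ x → *-comm (f x) k) (trans (∑-*ˡ xs k f) (*-comm k _))

∑-const : ∀ (xs : List X) k → (∑[ _ ∈ xs ] k) ≡ length xs * k
∑-const []       k = refl
∑-const (x ∷ xs) k = cong (k +_) (∑-const xs k)

∑-1 : ∀ (xs : List X) → (∑[ _ ∈ xs ] 1) ≡ length xs
∑-1 xs = trans (∑-const xs 1) (*-identityʳ _)

∑-swap : ∀ (xs : List X) (ys : List Y) (f : X → Y → ℕ) →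
         (∑[ x ∈ xs ] ∑[ y ∈ ys ] f x y) ≡ (∑[ y ∈ ys ] ∑[ x ∈ xs ] f x y)
∑-swap []       ys f = sym (trans (∑-const ys 0) (*-zeroʳ (length ys)))
∑-swap (x ∷ xs) ys f rewrite ∑-swap xs ys f = sym (∑-+ ys (f x) _)

∑-* : ∀ (xs : List X) (ys : List Y) (f : X → ℕ) (g : Y → ℕ) →
      (∑[ x ∈ xs ] ∑[ y ∈ ys ] f x * g y) ≡ ∑ xs f * ∑ ys g
∑-* xs ys f g = trans (∑-cong xs λ x → ∑-*ˡ ys (f x) g) (∑-*ʳ xs f (∑ ys g))

∑-map : ∀ (h : X → Y) (xs : List X) (f : Y → ℕ) → ∑ (map h xs) f ≡ (∑[ x ∈ xs ] f (h x))
∑-map h xs f = cong sum (sym (map-∘ xs))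

∑-cartesianProductWith : ∀ (h : X → Y → Z) xs ys (f : Z → ℕ) →
  ∑ (cartesianProductWith h xs ys) f ≡ (∑[ x ∈ xs ] ∑[ y ∈ ys ] f (h x y))
∑-cartesianProductWith h []       ys f = refl
∑-cartesianProductWith h (x ∷ xs) ys f
  rewrite map-++ f (map (h x) ys) (cartesianProductWith h xs ys)
        | sum-++ (map f (map (h x) ys)) (map f (cartesianProductWith h xs ys))
        | ∑-map (h x) ys f
        = cong (_ +_) (∑-cartesianProductWith h xs ys f)

∑-cartesianProduct : ∀ (xs : List X) (ys : List Y) (f : X × Y → ℕ) →
  ∑ (cartesianProduct xs ys) f ≡ (∑[ x ∈ xs ] ∑[ y ∈ ys ] f (x , y))
∑-cartesianProduct = ∑-cartesianProductWith _,_

length-× : ∀ (xs : List X) (ys : List Y) → length (cartesianProduct xs ys) ≡ length xs * length ys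
length-× xs ys = trans (sym (∑-1 (cartesianProduct xs ys)))
  (trans (∑-cartesianProduct xs ys _) (trans (∑-cong xs λ _ → ∑-1 ys) (∑-const xs _)))

∈⇒≤∑ : ∀ {xs : List X} {x} (f : X → ℕ) → x ∈ xs → f x ≤ ∑ xs f
∈⇒≤∑ f (here refl) = m≤m+n _ _
∈⇒≤∑ f (there m)   = ≤-trans (∈⇒≤∑ f m) (m≤n+m _ _)

-- Iverson brackets

⟦_⟧ : Dec P → ℕ
⟦ yes _ ⟧ = 1
⟦ no  _ ⟧ = 0

⟦⟧-true : (p? : Dec P) → P → ⟦ p? ⟧ ≡ 1
⟦⟧-true (yes _) p = refl
⟦⟧-true (no ¬p) p = contradiction p ¬p

⟦⟧-false : (p? : Dec P) → ¬ P → ⟦ p? ⟧ ≡ 0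
⟦⟧-false (yes p) ¬p = contradiction p ¬p
⟦⟧-false (no _)  ¬p = refl

⟦⟧≤1 : (p? : Dec P) → ⟦ p? ⟧ ≤ 1
⟦⟧≤1 (yes _) = ≤-refl
⟦⟧≤1 (no _)  = z≤n

⟦⟧-mono : (p? : Dec P) (q? : Dec Q) → (P → Q) → ⟦ p? ⟧ ≤ ⟦ q? ⟧
⟦⟧-mono (yes p) q? f = ≤-reflexive (sym (⟦⟧-true q? (f p)))
⟦⟧-mono (no _)  q? f = z≤n

⟦⟧-cong : (p? : Dec P) (q? : Dec Q) → (P → Q) → (Q → P) → ⟦ p? ⟧ ≡ ⟦ q? ⟧
⟦⟧-cong p? q? f g = ≤-antisym (⟦⟧-mono p? q? f) (⟦⟧-mono q? p? g)

⟦⟧-× : (p? : Dec P) (q? : Dec Q) → ⟦ p? ⟧ * ⟦ q? ⟧ ≡ ⟦ p? ×-dec q? ⟧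
⟦⟧-× (yes _) (yes _) = refl
⟦⟧-× (yes _) (no _)  = refl
⟦⟧-× (no _)  _       = refl

length-filter : ∀ {R : X → Set} (R? : ∀ x → Dec (R x)) xs →
                length (filter R? xs) ≡ (∑[ x ∈ xs ] ⟦ R? x ⟧)
length-filter R? []       = refl
length-filter R? (x ∷ xs) with R? x
... | yes _ = cong suc (length-filter R? xs)
... | no _  = length-filter R? xs

module _ {R : X → Set} (R? : ∀ x → Dec (R x)) where

  ∑⟦⟧≡0 : ∀ xs → (∀ {x} → x ∈ xs → ¬ R x) → (∑[ x ∈ xs ] ⟦ R? x ⟧) ≡ 0
  ∑⟦⟧≡0 []       h = refl
  ∑⟦⟧≡0 (x ∷ xs) h rewrite ⟦⟧-false (R? x) (h (here refl)) = ∑⟦⟧≡0 xs (λ m → h (there m))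

  ∑⟦⟧≤1 : ∀ {xs} → Unique xs → (∀ {x y} → x ∈ xs → y ∈ xs → R x → R y → x ≡ y) →
          (∑[ x ∈ xs ] ⟦ R? x ⟧) ≤ 1
  ∑⟦⟧≤1 [] h = z≤n
  ∑⟦⟧≤1 {x ∷ xs} (x∉ ∷ uq) h with R? x
  ... | no _  = ∑⟦⟧≤1 uq (λ m n → h (there m) (there n))
  ... | yes r = ≤-reflexive (cong suc (∑⟦⟧≡0 xs
        (λ m r′ → All.lookup x∉ m (h (here refl) (there m) r r′))))

  ∑⟦⟧≡1 : ∀ {xs x₀} → Unique xs → x₀ ∈ xs → R x₀ → (∀ {x} → R x → x ≡ x₀) →
          (∑[ x ∈ xs ] ⟦ R? x ⟧) ≡ 1
  ∑⟦⟧≡1 {xs} {x₀} uq m r h = ≤-antisym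
    (∑⟦⟧≤1 uq (λ _ _ r₁ r₂ → trans (h r₁) (sym (h r₂))))
    (≤-trans (≤-reflexive (sym (⟦⟧-true (R? x₀) r))) (∈⇒≤∑ (λ x → ⟦ R? x ⟧) m))

module _ (_≟_ : DecidableEquality X) where

  ∑-pick : ∀ {xs y} (f : X → ℕ) → Unique xs → y ∈ xs → (∑[ x ∈ xs ] ⟦ x ≟ y ⟧ * f x) ≡ f y
  ∑-pick {xs} {y} f uq m = trans (∑-cong xs pw) (trans (∑-*ʳ xs _ (f y))
    (trans (cong (_* f y) (∑⟦⟧≡1 (_≟ y) uq m refl (λ e → e))) (+-identityʳ _)))
    where
    pw : ∀ x → ⟦ x ≟ y ⟧ * f x ≡ ⟦ x ≟ y ⟧ * f y
    pw x with x ≟ y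
    ... | yes refl = refl
    ... | no _     = refl

  -- For a duplicate-free list this is the indicator function of the set it represents, the form in
  -- which a subset enters a sum over the whole type.
  multiplicity : List X → X → ℕ
  multiplicity xs y = ∑[ x ∈ xs ] ⟦ y ≟ x ⟧

  multiplicity≤1 : ∀ {xs} → Unique xs → ∀ y → multiplicity xs y ≤ 1
  multiplicity≤1 uq y = ∑⟦⟧≤1 (y ≟_) uq (λ _ _ e₁ e₂ → trans (sym e₁) e₂)

  ∑-multiplicity : ∀ xs {ys} (f : X → ℕ) → Unique ys → (∀ {x} → x ∈ ys) →
                   (∑[ y ∈ ys ] multiplicity xs y * f y) ≡ ∑ xs f
  ∑-multiplicity xs {ys} f uq complete = trans (∑-cong ys λ y → sym (∑-*ʳ xs _ (f y)))
    (trans (∑-swap ys xs _) (∑-cong xs λ x → ∑-pick f uq complete))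

  -- Every element of `xs` selects its own value from the sum over `ys`. After exchanging the sums,
  -- `y` carries its multiplicity in `xs` as weight, which is at most 1.
  ∑-⊆ : ∀ {xs ys} (f : X → ℕ) → Unique xs → (∀ {x} → x ∈ xs → x ∈ ys) → ∑ xs f ≤ ∑ ys f
  ∑-⊆ {xs} {ys} f uq sub = begin
    ∑ xs f                                    ≤⟨ ∑-mono-∈ xs pw ⟩
    (∑[ x ∈ xs ] ∑[ y ∈ ys ] ⟦ y ≟ x ⟧ * f y) ≡⟨ ∑-swap xs ys _ ⟩
    (∑[ y ∈ ys ] ∑[ x ∈ xs ] ⟦ y ≟ x ⟧ * f y) ≡⟨ ∑-cong ys (λ y → ∑-*ʳ xs _ (f y)) ⟩
    (∑[ y ∈ ys ] multiplicity xs y * f y)     ≤⟨ ∑-mono ys (λ y → *-monoˡ-≤ (f y) (multiplicity≤1 uq y)) ⟩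
    (∑[ y ∈ ys ] 1 * f y)                     ≡⟨ ∑-cong ys (λ y → +-identityʳ (f y)) ⟩
    ∑ ys f                                    ∎
    where
    open ≤-Reasoning
    pw : ∀ {x} → x ∈ xs → f x ≤ (∑[ y ∈ ys ] ⟦ y ≟ x ⟧ * f y)
    pw {x} m = ≤-trans
      (≤-reflexive (sym (trans (cong (_* f x) (⟦⟧-true (x ≟ x) refl)) (+-identityʳ _))))
      (∈⇒≤∑ (λ y → ⟦ y ≟ x ⟧ * f y) (sub m))

  length-⊆ : ∀ {xs ys : List X} → Unique xs → (∀ {x} → x ∈ xs → x ∈ ys) → length xs ≤ length ys
  length-⊆ {xs} {ys} uq sub = subst₂ _≤_ (∑-1 xs) (∑-1 ys) (∑-⊆ (λ _ → 1) uq sub)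

-- Quadratic inequalities

-- Over the naturals, the larger number is written as the smaller plus k; the two sides then differ
-- by k².
2xy≤x²+y² : ∀ x y → 2 * (x * y) ≤ x * x + y * y
2xy≤x²+y² x y with ≤-total x y
... | inj₁ x≤y = subst (λ y → 2 * (x * y) ≤ x * x + y * y) (m+[n∸m]≡n x≤y) (lemma x (y ∸ x))
  where
  identity : ∀ x k → 2 * (x * (x + k)) + k * k ≡ x * x + (x + k) * (x + k)
  identity = solve-∀
  lemma : ∀ x k → 2 * (x * (x + k)) ≤ x * x + (x + k) * (x + k)
  lemma x k = ≤-trans (m≤m+n _ (k * k)) (≤-reflexive (identity x k))
... | inj₂ y≤x = subst (λ x → 2 * (x * y) ≤ x * x + y * y) (m+[n∸m]≡n y≤x) (lemma y (x ∸ y))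
  where
  identity : ∀ y k → 2 * ((y + k) * y) + k * k ≡ (y + k) * (y + k) + y * y
  identity = solve-∀
  lemma : ∀ y k → 2 * ((y + k) * y) ≤ (y + k) * (y + k) + y * y
  lemma y k = ≤-trans (m≤m+n _ (k * k)) (≤-reflexive (identity y k))

-- This is (y - x)(w - z) ≥ 0 with the negative products moved across.
rearrangement : ∀ {x y z w} → x ≤ y → z ≤ w → x * w + y * z ≤ x * z + y * w
rearrangement {x} {y} {z} {w} x≤y z≤w =
  subst₂ (λ y w → x * w + y * z ≤ x * z + y * w) (m+[n∸m]≡n x≤y) (m+[n∸m]≡n z≤w)
    (≤-trans (m≤m+n _ (i * j)) (≤-reflexive (identity x i z j)))
  where
  i = y ∸ x
  j = w ∸ z
  identity : ∀ x i z j → x * (z + j) + (x + i) * z + i * j ≡ x * z + (x + i) * (z + j)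
  identity = solve-∀

-- Sum 2xy ≤ x² + y² over all pairs of elements and halve.
cauchySchwarz : ∀ (xs : List X) (f : X → ℕ) → ∑ xs f * ∑ xs f ≤ length xs * (∑[ x ∈ xs ] f x * f x)
cauchySchwarz xs f = *-cancelˡ-≤ 2 (begin
  2 * (∑ xs f * ∑ xs f)                              ≡⟨ cong (2 *_) (∑-* xs xs f f) ⟨
  2 * (∑[ x ∈ xs ] ∑[ y ∈ xs ] f x * f y)            ≡⟨ ∑-*ˡ xs 2 _ ⟨
  (∑[ x ∈ xs ] 2 * (∑[ y ∈ xs ] f x * f y))          ≡⟨ ∑-cong xs (λ x → sym (∑-*ˡ xs 2 _)) ⟩
  (∑[ x ∈ xs ] ∑[ y ∈ xs ] 2 * (f x * f y))          ≤⟨ ∑-mono xs (λ x → ∑-mono xs λ y → 2xy≤x²+y² (f x) (f y)) ⟩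
  (∑[ x ∈ xs ] ∑[ y ∈ xs ] (f x * f x + f y * f y))  ≡⟨ ∑-cong xs (λ x → trans (∑-+ xs _ _) (cong (_+ S) (∑-const xs _))) ⟩
  (∑[ x ∈ xs ] (length xs * (f x * f x) + S))        ≡⟨ ∑-+ xs _ _ ⟩
  (∑[ x ∈ xs ] length xs * (f x * f x)) + (∑[ _ ∈ xs ] S) ≡⟨ cong₂ _+_ (∑-*ˡ xs (length xs) _) (∑-const xs S) ⟩
  length xs * S + length xs * S                      ≡⟨ double (length xs * S) ⟩
  2 * (length xs * S)                                ∎)
  where
  open ≤-Reasoning
  S = ∑[ x ∈ xs ] f x * f x
  double : ∀ t → t + t ≡ 2 * t
  double = solve-∀

module _ (_≟_ : DecidableEquality Y) {ys : List Y} (uq : Unique ys) (complete : ∀ {y} → y ∈ ys) where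

  -- Cauchy-Schwarz for the fibre sizes of `f`: they add up to `length xs`, and their squares add up
  -- to the number of colliding pairs.
  collisions : (xs : List X) (f : X → Y) →
    length xs * length xs ≤ length ys * (∑[ x ∈ xs ] ∑[ x′ ∈ xs ] ⟦ f x ≟ f x′ ⟧)
  collisions xs f = subst₂ (λ s t → s * s ≤ length ys * t) total squares (cauchySchwarz ys fibre)
    where
    fibre : Y → ℕ
    fibre y = ∑[ x ∈ xs ] ⟦ y ≟ f x ⟧
    total : ∑ ys fibre ≡ length xs
    total = trans (∑-swap ys xs _)
      (trans (∑-cong xs λ x → ∑⟦⟧≡1 (_≟ f x) uq complete refl (λ e → e)) (∑-1 xs))
    squares : (∑[ y ∈ ys ] fibre y * fibre y) ≡ (∑[ x ∈ xs ] ∑[ x′ ∈ xs ] ⟦ f x ≟ f x′ ⟧)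
    squares = trans (∑-cong ys λ y → sym (∑-* xs xs _ _))
      (trans (∑-swap ys xs _) (∑-cong xs λ x → trans (∑-swap ys xs _)
        (∑-cong xs λ x′ → ∑-pick _≟_ (λ y → ⟦ y ≟ f x′ ⟧) uq complete)))

-- Linear equations over the field.

module Plane (F : FiniteField) where
  open FiniteField F renaming (_+_ to _⊕_; _*_ to _⊗_; -_ to ⊖_)
  open M2 F

  private
    R : CommutativeRing 0ℓ 0ℓ
    R = record { isCommutativeRing = isCommutativeRing }
    module R = CommutativeRing R
  open SemiringSolver R.commutativeSemiring using (solve; _:+_; _:*_; _:=_)
  open GroupProperties R.+-group using () renaming (∙-cancelˡ to ⊕-cancelˡ; ∙-cancelʳ to ⊕-cancelʳ)

  q : ℕ
  q = card

  ⊖-⊕ : ∀ x y → (x ⊕ ⊖ y) ⊕ y ≡ x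
  ⊖-⊕ x y = trans (R.+-assoc x (⊖ y) y) (trans (cong (x ⊕_) (R.-‿inverseˡ y)) (R.+-identityʳ x))

  ⊕≡⇒≡⊖ : ∀ {x y z} → x ⊕ y ≡ z → x ≡ z ⊕ ⊖ y
  ⊕≡⇒≡⊖ {x} {y} {z} e = ⊕-cancelʳ y x (z ⊕ ⊖ y) (trans e (sym (⊖-⊕ z y)))

  ⊗-cancelˡ : ∀ {u x y} → u ≢ 0# → u ⊗ x ≡ u ⊗ y → x ≡ y
  ⊗-cancelˡ {u} {x} {y} u≢0 e with inverse u u≢0
  ... | v , uv≡1 = trans (sym (undo x)) (trans (cong (v ⊗_) e) (undo y))
    where
    undo : ∀ x → v ⊗ (u ⊗ x) ≡ x
    undo x = trans (solve 3 (λ u v x → v :* (u :* x) := u :* v :* x) refl u v x)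
      (trans (cong (_⊗ x) uv≡1) (R.*-identityˡ x))

  solvable : ∀ {a} k t → a ≢ 0# → ∃ λ x → a ⊗ x ⊕ k ≡ t
  solvable {a} k t a≢0 with inverse a a≢0
  ... | v , av≡1 = v ⊗ (t ⊕ ⊖ k) , trans (cong (_⊕ k) (trans (sym (R.*-assoc a v _))
      (trans (cong (_⊗ (t ⊕ ⊖ k)) av≡1) (R.*-identityˡ _)))) (⊖-⊕ t k)

  affine : ∀ {a} k t → a ≢ 0# → (∑[ x ∈ elements ] ⟦ (a ⊗ x ⊕ k) ≟ t ⟧) ≡ 1
  affine {a} k t a≢0 with solvable k t a≢0
  ... | x₀ , solution = ∑⟦⟧≡1 (λ x → (a ⊗ x ⊕ k) ≟ t) elements-unique (elements-complete x₀) solution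
          (λ e → ⊗-cancelˡ a≢0 (⊕-cancelʳ k _ _ (trans e (sym solution))))

  -- Vectors of the plane, linear forms and lines.

  V : Set
  V = Carrier × Carrier

  0V : V
  0V = 0# , 0#

  _≟V_ : DecidableEquality V
  _≟V_ = ≡-dec _≟_ _≟_

  dot : V → V → Carrier
  dot (a , b) (x , y) = a ⊗ x ⊕ b ⊗ y

  vectors : List V
  vectors = cartesianProduct elements elements

  vectors-unique : Unique vectors
  vectors-unique = cartesianProduct⁺ elements-unique elements-unique

  vectors-complete : ∀ {v} → v ∈ vectors
  vectors-complete {x , y} = ∈-cartesianProduct⁺ (elements-complete x) (elements-complete y)

  length-vectors : length vectors ≡ q * q
  length-vectors = length-× elements elements

  -- One coordinate of `u` is nonzero. The other coordinate of `v` is free, and the equation then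
  -- determines the remaining one.
  ∑-line : ∀ {u} t → u ≢ 0V → (∑[ v ∈ vectors ] ⟦ dot u v ≟ t ⟧) ≡ q
  ∑-line {a , b} t u≢0 = trans (∑-cartesianProduct elements elements _) (cases (a ≟ 0#))
    where
    cases : Dec (a ≡ 0#) → (∑[ x ∈ elements ] ∑[ y ∈ elements ] ⟦ (a ⊗ x ⊕ b ⊗ y) ≟ t ⟧) ≡ q
    cases (no a≢0) = trans (∑-swap elements elements _)
      (trans (∑-cong elements λ y → affine (b ⊗ y) t a≢0) (∑-1 elements))
    cases (yes a≡0) = trans (∑-cong elements λ x →
      trans (∑-cong elements λ y → cong (λ s → ⟦ s ≟ t ⟧) (R.+-comm (a ⊗ x) (b ⊗ y)))
        (affine (a ⊗ x) t (λ b≡0 → u≢0 (cong₂ _,_ a≡0 b≡0)))) (∑-1 elements)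

  -- The determinant of the two vectors is nonzero, stated without subtraction so that identities
  -- stay within reach of a commutative semiring solver.
  Independent : V → V → Set
  Independent (a , b) (c , d) = a ⊗ d ≢ b ⊗ c

  -- The equation says (α - β) x = (α - β) x′. Replacing α by δ + β turns this into an identity
  -- without negation.
  crossCancel : ∀ {α β x x′} → α ≢ β → α ⊗ x ⊕ β ⊗ x′ ≡ α ⊗ x′ ⊕ β ⊗ x → x ≡ x′
  crossCancel {α} {β} {x} {x′} α≢β e = ⊗-cancelˡ δ≢0
    (⊕-cancelʳ (β ⊗ x ⊕ β ⊗ x′) _ _ (trans (sym left) (trans e′ right)))
    where
    δ = α ⊕ ⊖ β
    α≡ : δ ⊕ β ≡ α
    α≡ = ⊖-⊕ α β
    δ≢0 : δ ≢ 0#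
    δ≢0 δ≡0 = α≢β (trans (sym α≡) (trans (cong (_⊕ β) δ≡0) (R.+-identityˡ β)))
    e′ : (δ ⊕ β) ⊗ x ⊕ β ⊗ x′ ≡ (δ ⊕ β) ⊗ x′ ⊕ β ⊗ x
    e′ = subst (λ α → α ⊗ x ⊕ β ⊗ x′ ≡ α ⊗ x′ ⊕ β ⊗ x) (sym α≡) e
    left : (δ ⊕ β) ⊗ x ⊕ β ⊗ x′ ≡ δ ⊗ x ⊕ (β ⊗ x ⊕ β ⊗ x′)
    left = solve 4 (λ δ β x x′ → (δ :+ β) :* x :+ β :* x′ := δ :* x :+ (β :* x :+ β :* x′)) refl δ β x x′
    right : (δ ⊕ β) ⊗ x′ ⊕ β ⊗ x ≡ δ ⊗ x′ ⊕ (β ⊗ x ⊕ β ⊗ x′)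
    right = solve 4 (λ δ β x x′ → (δ :+ β) :* x′ :+ β :* x := δ :* x′ :+ (β :* x :+ β :* x′)) refl δ β x x′

  -- Cramer's rule. To eliminate one coordinate, the combination that would subtract the two
  -- equations instead adds one to the reverse of the other, which leaves exactly the shape of
  -- `crossCancel`.
  independent-injective : ∀ {u v s t} → Independent u v → dot u s ≡ dot u t → dot v s ≡ dot v t → s ≡ t
  independent-injective {a , b} {c , d} {x , y} {x′ , y′} ind e₁ e₂ = cong₂ _,_
    (crossCancel ind (⊕-cancelʳ (b ⊗ d ⊗ y ⊕ b ⊗ d ⊗ y′) _ _
      (trans (sym (x-side a b c d x y x′ y′)) (trans
        (cong₂ (λ p r → d ⊗ p ⊕ b ⊗ r) e₁ (sym e₂))
        (trans (x-side a b c d x′ y′ x y) (R.+-congˡ (R.+-comm _ _)))))))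
    (crossCancel ind (⊕-cancelʳ (a ⊗ c ⊗ x ⊕ a ⊗ c ⊗ x′) _ _
      (trans (sym (y-side a b c d x y x′ y′)) (trans
        (cong₂ (λ p r → a ⊗ p ⊕ c ⊗ r) e₂ (sym e₁))
        (trans (y-side a b c d x′ y′ x y) (R.+-congˡ (R.+-comm _ _)))))))
    where
    x-side : ∀ a b c d x y x′ y′ → d ⊗ (a ⊗ x ⊕ b ⊗ y) ⊕ b ⊗ (c ⊗ x′ ⊕ d ⊗ y′)
           ≡ (a ⊗ d) ⊗ x ⊕ (b ⊗ c) ⊗ x′ ⊕ (b ⊗ d ⊗ y ⊕ b ⊗ d ⊗ y′)
    x-side = solve 8 (λ a b c d x y x′ y′ → d :* (a :* x :+ b :* y) :+ b :* (c :* x′ :+ d :* y′)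
           := (a :* d) :* x :+ (b :* c) :* x′ :+ (b :* d :* y :+ b :* d :* y′)) refl
    y-side : ∀ a b c d x y x′ y′ → a ⊗ (c ⊗ x ⊕ d ⊗ y) ⊕ c ⊗ (a ⊗ x′ ⊕ b ⊗ y′)
           ≡ (a ⊗ d) ⊗ y ⊕ (b ⊗ c) ⊗ y′ ⊕ (a ⊗ c ⊗ x ⊕ a ⊗ c ⊗ x′)
    y-side = solve 8 (λ a b c d x y x′ y′ → a :* (c :* x :+ d :* y) :+ c :* (a :* x′ :+ b :* y′)
           := (a :* d) :* y :+ (b :* c) :* y′ :+ (a :* c :* x :+ a :* c :* x′)) refl

  dot-zeroʳ : ∀ u → dot u 0V ≡ 0#
  dot-zeroʳ (a , b) = trans (cong₂ _⊕_ (R.zeroʳ a) (R.zeroʳ b)) (R.+-identityʳ 0#)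

  dot-comm : ∀ u v → dot u v ≡ dot v u
  dot-comm (a , b) (x , y) = cong₂ _⊕_ (R.*-comm a x) (R.*-comm b y)

  abstract
    -- Representatives of the q + 1 points of the projective line.
    directions : List V
    directions = (0# , 1#) ∷ map (1# ,_) elements

    length-directions : length directions ≡ suc q
    length-directions = cong suc (length-map (1# ,_) elements)

    directions-nonzero : ∀ {u} → u ∈ directions → u ≢ 0V
    directions-nonzero (here refl) e = 0≢1 (sym (cong proj₂ e))
    directions-nonzero (there m)   e with ∈-map⁻ (1# ,_) m
    ... | _ , _ , refl = 0≢1 (sym (cong proj₁ e))

    directions-unique : Unique directions
    directions-unique = All.tabulate new ∷ map⁺ (cong proj₂) elements-unique
      where
      new : ∀ {u} → u ∈ map (1# ,_) elements → (0# , 1#) ≢ u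
      new m e with ∈-map⁻ (1# ,_) m
      ... | _ , _ , refl = 0≢1 (cong proj₁ e)

    directions-independent : ∀ {u v} → u ∈ directions → v ∈ directions → u ≢ v → Independent u v
    directions-independent (here refl) (here refl) u≢v _ = u≢v refl
    directions-independent (here refl) (there n) u≢v e with ∈-map⁻ (1# ,_) n
    ... | s , _ , refl = 0≢1 (trans (sym (R.zeroˡ s)) (trans e (R.*-identityˡ 1#)))
    directions-independent (there m) (here refl) u≢v e with ∈-map⁻ (1# ,_) m
    ... | s , _ , refl = 0≢1 (sym (trans (sym (R.*-identityˡ 1#)) (trans e (R.zeroʳ s))))
    directions-independent (there m) (there n) u≢v e with ∈-map⁻ (1# ,_) m | ∈-map⁻ (1# ,_) n
    ... | s , _ , refl | s′ , _ , refl =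
      u≢v (cong (1# ,_) (sym (trans (sym (R.*-identityˡ s′)) (trans e (R.*-identityʳ s)))))

    ∞∈directions : (0# , 1#) ∈ directions
    ∞∈directions = here refl

    slope∈directions : ∀ s → (1# , s) ∈ directions
    slope∈directions s = there (∈-map⁺ (1# ,_) (elements-complete s))

  -- Matrices and their products with row vectors.

  col₁ col₂ row₁ row₂ : Mat → V
  col₁ m = m11 m , m21 m
  col₂ m = m12 m , m22 m
  row₁ m = m11 m , m12 m
  row₂ m = m21 m , m22 m

  fromCols : V → V → Mat
  fromCols (a , c) (b , d) = mat a b c d

  fromRows : V → V → Mat
  fromRows (a , b) (c , d) = mat a b c d

  0M : Mat
  0M = mat 0# 0# 0# 0#

  -- Enumeration by columns makes a condition on `u · x` split into one line condition for each
  -- column.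
  matrices : List Mat
  matrices = cartesianProductWith fromCols vectors vectors

  matrices-unique : Unique matrices
  matrices-unique = cartesianProductWith⁺ fromCols
    (λ e → cong col₁ e , cong col₂ e) vectors-unique vectors-unique

  matrices-complete : ∀ {x} → x ∈ matrices
  matrices-complete {x} =
    ∈-cartesianProductWith⁺ fromCols {a = col₁ x} {b = col₂ x} vectors-complete vectors-complete

  length-matrices : length matrices ≡ q * q * (q * q)
  length-matrices = trans (sym (∑-1 matrices)) (trans (∑-cartesianProductWith fromCols vectors vectors _)
    (trans (∑-cong vectors λ _ → ∑-1 vectors) (trans (∑-const vectors _)
      (cong₂ _*_ length-vectors length-vectors))))

  infixl 8 _·_
  _·_ : V → Mat → V
  u · m = dot u (col₁ m) , dot u (col₂ m)

  -- The two columns range independently over lines with q points each.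
  ∑-plane : ∀ {u} t → u ≢ 0V → (∑[ x ∈ matrices ] ⟦ (u · x) ≟V t ⟧) ≡ q * q
  ∑-plane {u} t u≢0 = trans (∑-cartesianProductWith fromCols vectors vectors _)
    (trans (∑-cong vectors λ v → ∑-cong vectors λ w → split v w)
      (trans (∑-* vectors vectors _ _) (cong₂ _*_ (∑-line (proj₁ t) u≢0) (∑-line (proj₂ t) u≢0))))
    where
    split : ∀ v w → ⟦ (u · fromCols v w) ≟V t ⟧ ≡ ⟦ dot u v ≟ proj₁ t ⟧ * ⟦ dot u w ≟ proj₂ t ⟧
    split v w = trans
      (⟦⟧-cong _ ((dot u v ≟ proj₁ t) ×-dec (dot u w ≟ proj₂ t))
        (λ e → cong proj₁ e , cong proj₂ e) (λ (e₁ , e₂) → cong₂ _,_ e₁ e₂))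
      (sym (⟦⟧-× (dot u v ≟ proj₁ t) (dot u w ≟ proj₂ t)))

  ·-injective : ∀ {u v x y} → Independent u v → u · x ≡ u · y → v · x ≡ v · y → x ≡ y
  ·-injective ind e₁ e₂ = cong₂ fromCols
    (independent-injective ind (cong proj₁ e₁) (cong proj₁ e₂))
    (independent-injective ind (cong proj₂ e₁) (cong proj₂ e₂))

  dot-⊕ : ∀ u x y x′ y′ → dot u (x ⊕ x′ , y ⊕ y′) ≡ dot u (x , y) ⊕ dot u (x′ , y′)
  dot-⊕ (a , b) = solve 6 (λ a b x y x′ y′ → a :* (x :+ x′) :+ b :* (y :+ y′)
    := (a :* x :+ b :* y) :+ (a :* x′ :+ b :* y′)) refl a b

  absorbed⇒0 : ∀ {x y} → x ⊕ y ≡ y → x ≡ 0#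
  absorbed⇒0 {x} {y} e = ⊕-cancelʳ y x 0# (trans e (sym (R.+-identityˡ y)))

  0⇒absorbed : ∀ {x y} → x ≡ 0# → x ⊕ y ≡ y
  0⇒absorbed {y = y} e = trans (cong (_⊕ y) e) (R.+-identityˡ y)

  -- Below, a pair a, a′ takes the form `z +M y`, `y` with difference `z`. Agreement of the pair
  -- after multiplication by `u` then means that `u` kills `z`; `annihilated` is the converse.
  annihilates : ∀ u z y → u · (z +M y) ≡ u · y → u · z ≡ 0V
  annihilates u z y e = cong₂ _,_
    (absorbed⇒0 (trans (sym (dot-⊕ u (m11 z) (m21 z) (m11 y) (m21 y))) (cong proj₁ e)))
    (absorbed⇒0 (trans (sym (dot-⊕ u (m12 z) (m22 z) (m12 y) (m22 y))) (cong proj₂ e)))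

  annihilated : ∀ u z y → u · z ≡ 0V → u · (z +M y) ≡ u · y
  annihilated u z y e = cong₂ _,_
    (trans (dot-⊕ u (m11 z) (m21 z) (m11 y) (m21 y)) (0⇒absorbed (cong proj₁ e)))
    (trans (dot-⊕ u (m12 z) (m22 z) (m12 y) (m22 y)) (0⇒absorbed (cong proj₂ e)))

  ·-*M : ∀ u z c → u · z ≡ 0V → u · (z *M c) ≡ 0V
  ·-*M u z c e = cong₂ _,_ (column (m11 c) (m21 c)) (column (m12 c) (m22 c))
    where
    column : ∀ x y → dot u (dot (row₁ z) (x , y) , dot (row₂ z) (x , y)) ≡ 0#
    column x y = trans
      (solve 8 (λ u v a b c d x y → u :* (a :* x :+ b :* y) :+ v :* (c :* x :+ d :* y)
        := (x :* (u :* a :+ v :* c) :+ y :* (u :* b :+ v :* d))) refl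
        (proj₁ u) (proj₂ u) (m11 z) (m12 z) (m21 z) (m22 z) x y)
      (trans (cong₂ (λ p r → x ⊗ p ⊕ y ⊗ r) (cong proj₁ e) (cong proj₂ e)) (dot-zeroʳ (x , y)))

  -- If the bottom row has a nonzero entry, choose s so that (1, s) kills the column of that entry.
  -- It kills the other column too, as one sees by multiplying by the nonzero entry and using that
  -- the determinant vanishes. If the bottom row is zero, (0, 1) works.
  singular⇒annihilated : ∀ z → m11 z ⊗ m22 z ≡ m12 z ⊗ m21 z → ∃ λ u → u ∈ directions × u · z ≡ 0V
  singular⇒annihilated (mat a b c d) ad≡bc with c ≟ 0# | d ≟ 0#
  ... | no c≢0 | _ with solvable a 0# c≢0
  ...   | s , e = (1# , s) , slope∈directions s , cong₂ _,_
          (trans (cong₂ _⊕_ (R.*-identityˡ a) (R.*-comm s c)) (trans (R.+-comm a (c ⊗ s)) e))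
          (trans (cong (_⊕ s ⊗ d) (R.*-identityˡ b)) (⊗-cancelˡ c≢0 (trans
            (solve 4 (λ b c d s → c :* (b :+ s :* d) := b :* c :+ c :* s :* d) refl b c d s)
            (trans (cong (_⊕ c ⊗ s ⊗ d) (sym ad≡bc)) (trans
            (solve 4 (λ a c d s → a :* d :+ c :* s :* d := (c :* s :+ a) :* d) refl a c d s)
            (trans (cong (_⊗ d) e) (trans (R.zeroˡ d) (sym (R.zeroʳ c)))))))))
  singular⇒annihilated (mat a b c d) ad≡bc | yes _ | no d≢0 with solvable b 0# d≢0
  ...   | s , e = (1# , s) , slope∈directions s , cong₂ _,_
          (trans (cong (_⊕ s ⊗ c) (R.*-identityˡ a)) (⊗-cancelˡ d≢0 (trans
            (solve 4 (λ a c d s → d :* (a :+ s :* c) := a :* d :+ d :* s :* c) refl a c d s)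
            (trans (cong (_⊕ d ⊗ s ⊗ c) ad≡bc) (trans
            (solve 4 (λ b c d s → b :* c :+ d :* s :* c := (d :* s :+ b) :* c) refl b c d s)
            (trans (cong (_⊗ c) e) (trans (R.zeroˡ c) (sym (R.zeroʳ d)))))))))
          (trans (cong₂ _⊕_ (R.*-identityˡ b) (R.*-comm s d)) (trans (R.+-comm b (d ⊗ s)) e))
  singular⇒annihilated (mat a b c d) ad≡bc | yes c≡0 | yes d≡0 = (0# , 1#) , ∞∈directions ,
    cong₂ _,_ (bottom a c≡0) (bottom b d≡0)
    where
    bottom : ∀ x {y} → y ≡ 0# → 0# ⊗ x ⊕ 1# ⊗ y ≡ 0#
    bottom x {y} y≡0 = trans (0⇒absorbed (R.zeroˡ x)) (trans (R.*-identityˡ y) y≡0)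

  -- The agreement kernel, and the number of c with a c + d = a′ c + d′.

  κ : V → Mat → Mat → ℕ
  κ u x y = ⟦ (u · x) ≟V (u · y) ⟧

  -- For x = y the value is q + 1; otherwise it is 1 or 0 according to whether x - y is singular or
  -- invertible.
  K : Mat → Mat → ℕ
  K x y = ∑[ u ∈ directions ] κ u x y

  hits : Mat → Mat → Mat → Mat → Mat → ℕ
  hits c a a′ d d′ = ⟦ ((a *M c) +M d) ≟M ((a′ *M c) +M d′) ⟧

  _-M_ : Mat → Mat → Mat
  x -M y = mat (m11 x ⊕ ⊖ m11 y) (m12 x ⊕ ⊖ m12 y) (m21 x ⊕ ⊖ m21 y) (m22 x ⊕ ⊖ m22 y)

  mat-cong : ∀ {a b c d a′ b′ c′ d′} → a ≡ a′ → b ≡ b′ → c ≡ c′ → d ≡ d′ → mat a b c d ≡ mat a′ b′ c′ d′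
  mat-cong refl refl refl refl = refl

  -M-+M : ∀ x y → (x -M y) +M y ≡ x
  -M-+M x y = mat-cong (⊖-⊕ _ _) (⊖-⊕ _ _) (⊖-⊕ _ _) (⊖-⊕ _ _)

  +M-cancelʳ : ∀ {x x′} y → x +M y ≡ x′ +M y → x ≡ x′
  +M-cancelʳ y e = mat-cong (⊕-cancelʳ _ _ _ (cong m11 e)) (⊕-cancelʳ _ _ _ (cong m12 e))
    (⊕-cancelʳ _ _ _ (cong m21 e)) (⊕-cancelʳ _ _ _ (cong m22 e))

  +M-cancelˡ : ∀ {x x′} y → y +M x ≡ y +M x′ → x ≡ x′
  +M-cancelˡ y e = mat-cong (⊕-cancelˡ _ _ _ (cong m11 e)) (⊕-cancelˡ _ _ _ (cong m12 e))
    (⊕-cancelˡ _ _ _ (cong m21 e)) (⊕-cancelˡ _ _ _ (cong m22 e))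

  -- (z + y) c + d = y c + d′ says that z c = d′ - d.
  difference : ∀ z y c d d′ → ((z +M y) *M c) +M d ≡ (y *M c) +M d′ → (z *M c) +M d ≡ d′
  difference z y c d d′ e = +M-cancelˡ (y *M c) (trans (mat-cong
      (entry (m11 z) (m12 z) (m11 y) (m12 y) (m11 c) (m21 c) (m11 d))
      (entry (m11 z) (m12 z) (m11 y) (m12 y) (m12 c) (m22 c) (m12 d))
      (entry (m21 z) (m22 z) (m21 y) (m22 y) (m11 c) (m21 c) (m21 d))
      (entry (m21 z) (m22 z) (m21 y) (m22 y) (m12 c) (m22 c) (m22 d))) e)
    where
    entry : ∀ z₁ z₂ y₁ y₂ c₁ c₂ d → (y₁ ⊗ c₁ ⊕ y₂ ⊗ c₂) ⊕ ((z₁ ⊗ c₁ ⊕ z₂ ⊗ c₂) ⊕ d)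
          ≡ ((z₁ ⊕ y₁) ⊗ c₁ ⊕ (z₂ ⊕ y₂) ⊗ c₂) ⊕ d
    entry = solve 7 (λ z₁ z₂ y₁ y₂ c₁ c₂ d → (y₁ :* c₁ :+ y₂ :* c₂) :+ ((z₁ :* c₁ :+ z₂ :* c₂) :+ d)
          := ((z₁ :+ y₁) :* c₁ :+ (z₂ :+ y₂) :* c₂) :+ d) refl

  ·-0M : ∀ u → u · 0M ≡ 0V
  ·-0M u = cong₂ _,_ (dot-zeroʳ u) (dot-zeroʳ u)

  0M-+M : ∀ {z} y → z ≡ 0M → z +M y ≡ y
  0M-+M y refl = mat-cong (R.+-identityˡ _) (R.+-identityˡ _) (R.+-identityˡ _) (R.+-identityˡ _)

  hits-diagonal : ∀ a d d′ → (∑[ c ∈ matrices ] hits c a a d d′) ≤ q * q * (q * q) * ⟦ d ≟M d′ ⟧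
  hits-diagonal a d d′ = begin
    (∑[ c ∈ matrices ] hits c a a d d′) ≤⟨ ∑-mono matrices (λ c → ⟦⟧-mono _ (d ≟M d′) (+M-cancelˡ (a *M c))) ⟩
    (∑[ c ∈ matrices ] ⟦ d ≟M d′ ⟧)     ≡⟨ ∑-const matrices _ ⟩
    length matrices * ⟦ d ≟M d′ ⟧       ≡⟨ cong (_* ⟦ d ≟M d′ ⟧) length-matrices ⟩
    q * q * (q * q) * ⟦ d ≟M d′ ⟧       ∎
    where open ≤-Reasoning

  K≤suc-q : ∀ x y → K x y ≤ suc q
  K≤suc-q x y = ≤-trans (∑-mono directions (λ u → ⟦⟧≤1 ((u · x) ≟V (u · y))))
    (≤-reflexive (trans (∑-1 directions) length-directions))

  module _ (z y d d′ : Mat) where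

    private
      Hit : Mat → Set
      Hit c = ((z +M y) *M c) +M d ≡ (y *M c) +M d′

    -- Two solutions c, c′ satisfy z c = z c′, and z can be cancelled.
    hits-invertible : Independent (row₁ z) (row₂ z) → (∑[ c ∈ matrices ] hits c (z +M y) y d d′) ≤ 1
    hits-invertible ind = ∑⟦⟧≤1 (λ c → _ ≟M _) matrices-unique λ {c} {c′} _ _ e e′ →
      let zc≡zc′ = +M-cancelʳ d (trans (difference z y c d d′ e) (sym (difference z y c′ d d′ e′)))
      in ·-injective ind (cong row₁ zc≡zc′) (cong row₂ zc≡zc′)

    K-invertible : Independent (row₁ z) (row₂ z) → K (z +M y) y ≡ 0
    K-invertible ind = ∑⟦⟧≡0 (λ u → (u · (z +M y)) ≟V (u · y)) directions λ {u} m e →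
      let uz≡0 = annihilates u z y e in
      directions-nonzero m (independent-injective {col₁ z} {col₂ z} {u} {0V}
        (λ e → ind (trans e (R.*-comm _ _)))
        (trans (dot-comm (col₁ z) u) (trans (cong proj₁ uz≡0) (sym (dot-zeroʳ (col₁ z)))))
        (trans (dot-comm (col₂ z) u) (trans (cong proj₂ uz≡0) (sym (dot-zeroʳ (col₂ z))))))

    -- Two distinct directions are independent, so only the zero matrix is killed by both.
    K-nonzero : z ≢ 0M → K (z +M y) y ≤ 1
    K-nonzero z≢0 = ∑⟦⟧≤1 (λ u → (u · (z +M y)) ≟V (u · y)) directions-unique same
      where
      same : ∀ {u v} → u ∈ directions → v ∈ directions →
             u · (z +M y) ≡ u · y → v · (z +M y) ≡ v · y → u ≡ v
      same {u} {v} m n e e′ with u ≟V v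
      ... | yes u≡v = u≡v
      ... | no u≢v  = contradiction (·-injective (directions-independent m n u≢v)
              (trans (annihilates u z y e) (sym (·-0M u)))
              (trans (annihilates v z y e′) (sym (·-0M v)))) z≢0

    -- A row ρ of z prescribes ρ · c, which leaves q² candidates. Since u kills z, it kills z c = d′
    -- - d as well, so there is no solution at all unless u · d = u · d′.
    hits-viaRow : ∀ {u} ρ t → ρ ≢ 0V → u · z ≡ 0V → (∀ c → Hit c → ρ · c ≡ t) →
      (∑[ c ∈ matrices ] hits c (z +M y) y d d′) ≤ q * q * κ u d d′
    hits-viaRow {u} ρ t ρ≢0 uz≡0 h = ≤-trans (∑-mono matrices pw)
      (≤-reflexive (trans (∑-*ʳ matrices (λ c → ⟦ (ρ · c) ≟V t ⟧) _) (cong (_* κ u d d′) (∑-plane t ρ≢0))))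
      where
      pw : ∀ c → hits c (z +M y) y d d′ ≤ ⟦ (ρ · c) ≟V t ⟧ * κ u d d′
      pw c = ≤-trans (⟦⟧-mono _ (((ρ · c) ≟V t) ×-dec ((u · d) ≟V (u · d′))) λ hit →
          h c hit , trans (sym (annihilated u (z *M c) d (·-*M u z c uz≡0)))
                          (cong (u ·_) (difference z y c d d′ hit)))
        (≤-reflexive (sym (⟦⟧-× ((ρ · c) ≟V t) _)))

    hits-singular : ∀ {u} → z ≢ 0M → u · z ≡ 0V →
      (∑[ c ∈ matrices ] hits c (z +M y) y d d′) ≤ q * q * κ u d d′
    hits-singular z≢0 uz≡0 with row₁ z ≟V 0V | row₂ z ≟V 0V
    ... | yes r₁  | yes r₂ = contradiction (cong₂ fromRows r₁ r₂) z≢0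
    ... | no r₁≢0 | _ = hits-viaRow (row₁ z) (row₁ (d′ -M d)) r₁≢0 uz≡0 λ c hit →
      let e = difference z y c d d′ hit in cong₂ _,_ (⊕≡⇒≡⊖ (cong m11 e)) (⊕≡⇒≡⊖ (cong m12 e))
    ... | yes _ | no r₂≢0 = hits-viaRow (row₂ z) (row₂ (d′ -M d)) r₂≢0 uz≡0 λ c hit →
      let e = difference z y c d d′ hit in cong₂ _,_ (⊕≡⇒≡⊖ (cong m21 e)) (⊕≡⇒≡⊖ (cong m22 e))

    -- Read as a bound by 1 - `K` plus the kernel term: the 1 pays for an invertible difference,
    -- where `K` vanishes, and is given back for a rank one difference. This saving later cancels
    -- the main part of the kernel term.
    hits-offDiagonal : z ≢ 0M → (∑[ c ∈ matrices ] hits c (z +M y) y d d′) + K (z +M y) y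
      ≤ 1 + q * q * (∑[ u ∈ directions ] κ u (z +M y) y * κ u d d′)
    hits-offDiagonal z≢0 with (m11 z ⊗ m22 z) ≟ (m12 z ⊗ m21 z)
    ... | no ind = +-mono-≤ (hits-invertible ind) (≤-trans (≤-reflexive (K-invertible ind)) z≤n)
    ... | yes sing with singular⇒annihilated z sing
    -- The sum over directions is at least its term at the annihilating `u`, whose first factor is
    -- 1.
    ...   | u , m , uz≡0 = ≤-trans (+-mono-≤ (hits-singular z≢0 uz≡0) (K-nonzero z≢0))
            (≤-trans (≤-reflexive (+-comm _ 1)) (s≤s (*-monoʳ-≤ (q * q) (≤-trans
              (≤-reflexive (sym (trans (cong (_* κ u d d′) (⟦⟧-true (_ ≟V _) (annihilated u z y uz≡0)))
                (+-identityʳ _))))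
              (∈⇒≤∑ (λ u → κ u (z +M y) y * κ u d d′) m)))))

  -- The last two terms absorb the diagonal a = a′: there `K` may be as large as q + 1 = 1 + q, and
  -- every one of the q⁴ matrices c is a solution when d = d′.
  hits-total : ∀ a a′ d d′ → (∑[ c ∈ matrices ] hits c a a′ d d′) + K a a′
    ≤ 1 + q * q * (∑[ u ∈ directions ] κ u a a′ * κ u d d′)
      + q * ⟦ a ≟M a′ ⟧ + q * q * (q * q) * (⟦ a ≟M a′ ⟧ * ⟦ d ≟M d′ ⟧)
  hits-total a a′ d d′ with a ≟M a′
  ... | yes refl = ≤-trans (+-mono-≤ (hits-diagonal a d d′) (K≤suc-q a a))
        (≤-trans (m≤m+n _ (q * q * W)) (≤-reflexive (shape q W ⟦ d ≟M d′ ⟧)))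
    where
    W = ∑[ u ∈ directions ] κ u a a * κ u d d′
    shape : ∀ q W δ → q * q * (q * q) * δ + suc q + q * q * W
          ≡ 1 + q * q * W + q * 1 + q * q * (q * q) * (1 * δ)
    shape = solve-∀
  ... | no a≢a′ = ≤-trans
        (subst (λ a → (∑[ c ∈ matrices ] hits c a a′ d d′) + K a a′
                      ≤ 1 + q * q * (∑[ u ∈ directions ] κ u a a′ * κ u d d′))
          (-M-+M a a′) (hits-offDiagonal (a -M a′) a′ d d′
            (λ z≡0 → a≢a′ (trans (sym (-M-+M a a′)) (0M-+M a′ z≡0)))))
        (≤-trans (m≤m+n _ _) (m≤m+n _ _))

  -- Expand over pairs of directions u, v. If u ≠ v, at most one x has both prescribed products. If
  -- u = v, there are q² such x when d and d′ agree along u, and none otherwise. The q + 1 on the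
  -- left discounts the diagonal pairs from the (q + 1)² ones.
  K-convolution : ∀ d d′ → (∑[ x ∈ matrices ] K x d * K x d′) + suc q ≤ suc q * suc q + q * q * K d d′
  K-convolution d d′ = begin
    (∑[ x ∈ matrices ] K x d * K x d′) + suc q
      ≡⟨ cong₂ _+_ expand (trans (sym length-directions) (sym (∑-1 directions))) ⟩
    (∑[ u ∈ directions ] ∑[ v ∈ directions ] J u v) + (∑[ u ∈ directions ] 1)
      ≡⟨ ∑-+ directions _ _ ⟨
    (∑[ u ∈ directions ] ((∑[ v ∈ directions ] J u v) + 1))
      ≤⟨ ∑-mono-∈ directions inner ⟩
    (∑[ u ∈ directions ] (suc q + q * q * κ u d d′))
      ≡⟨ ∑-+ directions _ _ ⟩
    (∑[ u ∈ directions ] suc q) + (∑[ u ∈ directions ] q * q * κ u d d′)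
      ≡⟨ cong₂ _+_ (trans (∑-const directions _) (cong (_* suc q) length-directions)) (∑-*ˡ directions (q * q) _) ⟩
    suc q * suc q + q * q * K d d′ ∎
    where
    open ≤-Reasoning
    J : V → V → ℕ
    J u v = ∑[ x ∈ matrices ] κ u x d * κ v x d′

    expand : (∑[ x ∈ matrices ] K x d * K x d′) ≡ (∑[ u ∈ directions ] ∑[ v ∈ directions ] J u v)
    expand = trans (∑-cong matrices λ x → sym (∑-* directions directions _ _))
      (trans (∑-swap matrices directions _) (∑-cong directions λ u → ∑-swap matrices directions _))

    -- The bracket on the left cancels the 1 when v = u, so that one formula covers both cases and
    -- can be summed over v.
    J-bound : ∀ {u v} → u ∈ directions → v ∈ directions →
              J u v + ⟦ v ≟V u ⟧ ≤ 1 + ⟦ v ≟V u ⟧ * (q * q * κ u d d′)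
    J-bound {u} {v} m n with v ≟V u
    ... | yes refl = ≤-trans (+-monoˡ-≤ 1 J≤) (≤-reflexive (trans (+-comm _ 1) (cong suc (sym (+-identityʳ _)))))
      where
      pw : ∀ x → κ u x d * κ u x d′ ≤ κ u x d * κ u d d′
      pw x = ≤-trans (≤-reflexive (⟦⟧-× ((u · x) ≟V (u · d)) ((u · x) ≟V (u · d′))))
        (≤-trans (⟦⟧-mono _ (((u · x) ≟V (u · d)) ×-dec ((u · d) ≟V (u · d′)))
          (λ (e , e′) → e , trans (sym e) e′)) (≤-reflexive (sym (⟦⟧-× ((u · x) ≟V (u · d)) _))))
      J≤ : J u u ≤ q * q * κ u d d′
      J≤ = ≤-trans (∑-mono matrices pw) (≤-reflexive (trans (∑-*ʳ matrices (λ x → κ u x d) _)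
        (cong (_* κ u d d′) (∑-plane (u · d) (directions-nonzero m)))))
    ... | no v≢u = ≤-trans (≤-reflexive (trans (+-identityʳ _) (∑-cong matrices λ x →
        ⟦⟧-× ((u · x) ≟V (u · d)) ((v · x) ≟V (v · d′)))))
      (∑⟦⟧≤1 (λ x → ((u · x) ≟V (u · d)) ×-dec ((v · x) ≟V (v · d′))) matrices-unique
        λ _ _ (e₁ , e₂) (f₁ , f₂) → ·-injective
          (directions-independent m n (λ e → v≢u (sym e))) (trans e₁ (sym f₁)) (trans e₂ (sym f₂)))

    inner : ∀ {u} → u ∈ directions → (∑[ v ∈ directions ] J u v) + 1 ≤ suc q + q * q * κ u d d′
    inner {u} m = begin
      (∑[ v ∈ directions ] J u v) + 1
        ≡⟨ cong (∑ directions (J u) +_) (∑⟦⟧≡1 (_≟V u) directions-unique m refl (λ e → e)) ⟨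
      (∑[ v ∈ directions ] J u v) + (∑[ v ∈ directions ] ⟦ v ≟V u ⟧)
        ≡⟨ ∑-+ directions _ _ ⟨
      (∑[ v ∈ directions ] (J u v + ⟦ v ≟V u ⟧))
        ≤⟨ ∑-mono-∈ directions (J-bound m) ⟩
      (∑[ v ∈ directions ] (1 + ⟦ v ≟V u ⟧ * (q * q * κ u d d′)))
        ≡⟨ ∑-+ directions _ _ ⟩
      (∑[ v ∈ directions ] 1) + (∑[ v ∈ directions ] ⟦ v ≟V u ⟧ * (q * q * κ u d d′))
        ≡⟨ cong₂ _+_ (trans (∑-1 directions) length-directions)
             (∑-pick _≟V_ (λ _ → q * q * κ u d d′) directions-unique m) ⟩
      suc q + q * q * κ u d d′ ∎

  -- The second moment over all matrices.

  instance
    q-nonZero : NonZero q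
    q-nonZero = >-nonZero (≤-trans (∈⇒≤∑ (λ _ → 1) (elements-complete 0#)) (≤-reflexive (∑-1 elements)))

    q²-nonZero : NonZero (q * q)
    q²-nonZero = m*n≢0 q q

    q⁴-nonZero : NonZero (q * q * (q * q))
    q⁴-nonZero = m*n≢0 (q * q) (q * q)

  length≤q⁴ : ∀ {D : List Mat} → Unique D → length D ≤ q * q * (q * q)
  length≤q⁴ uq = ≤-trans (length-⊆ _≟M_ uq (λ _ → matrices-complete)) (≤-reflexive length-matrices)

  module SecondMoment {D : List Mat} (uq : Unique D) where

    n = length D
    a = q * q
    k = suc q

    H : Mat → ℕ
    H x = ∑[ d ∈ D ] K x d

    T = ∑ D H

    ∑H : ∑ matrices H ≡ n * (k * a)
    ∑H = trans (∑-swap matrices D K) (trans (∑-cong D λ d → trans (∑-swap matrices directions _)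
      (trans (∑-cong-∈ directions λ {u} m → ∑-plane (u · d) (directions-nonzero m))
        (trans (∑-const directions a) (cong (_* a) length-directions)))) (∑-const D _))

    -- `K-convolution` summed over pairs from `D`. The term n²k on the left is what brings the
    -- coefficient of n² in `secondMoment` down from 2k to k, its exact main term.
    ∑H² : (∑[ x ∈ matrices ] H x * H x) + n * (n * k) ≤ n * (n * (k * k)) + a * T
    ∑H² = begin
      (∑[ x ∈ matrices ] H x * H x) + n * (n * k)
        ≡⟨ cong₂ _+_ expand (sym (trans (∑-cong D λ _ → ∑-const D k) (∑-const D (n * k)))) ⟩
      (∑[ d ∈ D ] ∑[ d′ ∈ D ] I d d′) + (∑[ d ∈ D ] ∑[ d′ ∈ D ] k)
        ≡⟨ ∑-+ D _ _ ⟨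
      (∑[ d ∈ D ] ((∑[ d′ ∈ D ] I d d′) + (∑[ d′ ∈ D ] k)))
        ≡⟨ ∑-cong D (λ d → ∑-+ D (I d) (λ _ → k)) ⟨
      (∑[ d ∈ D ] ∑[ d′ ∈ D ] (I d d′ + k))
        ≤⟨ ∑-mono D (λ d → ∑-mono D λ d′ → K-convolution d d′) ⟩
      (∑[ d ∈ D ] ∑[ d′ ∈ D ] (k * k + a * K d d′))
        ≡⟨ ∑-cong D (λ d → trans (∑-+ D (λ _ → k * k) (λ d′ → a * K d d′))
             (cong₂ _+_ (∑-const D (k * k)) (∑-*ˡ D a (K d)))) ⟩
      (∑[ d ∈ D ] (n * (k * k) + a * H d))
        ≡⟨ ∑-+ D _ _ ⟩
      (∑[ d ∈ D ] n * (k * k)) + (∑[ d ∈ D ] a * H d)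
        ≡⟨ cong₂ _+_ (∑-const D _) (∑-*ˡ D a H) ⟩
      n * (n * (k * k)) + a * T ∎
      where
      open ≤-Reasoning
      I : Mat → Mat → ℕ
      I d d′ = ∑[ x ∈ matrices ] K x d * K x d′
      expand : (∑[ x ∈ matrices ] H x * H x) ≡ (∑[ d ∈ D ] ∑[ d′ ∈ D ] I d d′)
      expand = trans (∑-cong matrices λ x → sym (∑-* D D (K x) (K x)))
        (trans (∑-swap matrices D _) (∑-cong D λ d → ∑-swap matrices D _))

    -- The constants come from expanding ∑ₓ (a H(x) - (k n + a² 1_D(x)))² ≥ 0.
    secondMoment : a * T ≤ k * (n * n) + a * a * n
    secondMoment = +-cancelˡ-≤ (common) _ _ (*-cancelˡ-≤ (a * a) (begin
      a * a * (common + a * T)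
        ≡⟨ shapeˡ a k n T ⟩
      2 * a * b * (n * (k * a)) + 2 * a * a * a * T + a * a * (n * (n * k))
        ≤⟨ +-monoˡ-≤ _ summed ⟩
      a * a * S₂ + (a * a * (b * b) + (2 * b * (a * a) + a * a * (a * a)) * n) + a * a * (n * (n * k))
        ≡⟨ regroup a n k S₂ _ ⟩
      a * a * (S₂ + n * (n * k)) + (a * a * (b * b) + (2 * b * (a * a) + a * a * (a * a)) * n)
        ≤⟨ +-monoˡ-≤ _ (*-monoʳ-≤ (a * a) ∑H²) ⟩
      a * a * (n * (n * (k * k)) + a * T) + (a * a * (b * b) + (2 * b * (a * a) + a * a * (a * a)) * n)
        ≡⟨ shapeʳ a k n T ⟩
      a * a * (common + (k * (n * n) + a * a * n)) ∎))
      where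
      open ≤-Reasoning
      b = k * n
      S₂ = ∑[ x ∈ matrices ] H x * H x
      i : Mat → ℕ
      i = multiplicity _≟M_ D
      -- What remains on both sides, after division by a² = q⁴, once `S₂` is eliminated through
      -- `∑H²`.
      common : ℕ
      common = 2 * (k * k * (n * n)) + n * n * k + a * T

      shapeˡ : ∀ a k n T → a * a * (2 * (k * k * (n * n)) + n * n * k + a * T + a * T)
        ≡ 2 * a * (k * n) * (n * (k * a)) + 2 * a * a * a * T + a * a * (n * (n * k))
      shapeˡ = solve-∀
      shapeʳ : ∀ a k n T → a * a * (n * (n * (k * k)) + a * T)
          + (a * a * (k * n * (k * n)) + (2 * (k * n) * (a * a) + a * a * (a * a)) * n)
        ≡ a * a * (2 * (k * k * (n * n)) + n * n * k + a * T + (k * (n * n) + a * a * n))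
      shapeʳ = solve-∀
      regroup : ∀ a n k S r → a * a * S + r + a * a * (n * (n * k)) ≡ a * a * (S + n * (n * k)) + r
      regroup = solve-∀

      pointwise : ∀ x → 2 * a * b * H x + 2 * a * a * a * (i x * H x)
        ≤ a * a * (H x * H x) + (b * b + (2 * b * (a * a) + a * a * (a * a)) * (i x * 1))
      pointwise x = begin
        2 * a * b * H x + 2 * a * a * a * (i x * H x)
          ≡⟨ expandˡ a b (H x) (i x) ⟩
        2 * (a * H x * (b + a * a * i x))
          ≤⟨ 2xy≤x²+y² (a * H x) (b + a * a * i x) ⟩
        a * H x * (a * H x) + (b + a * a * i x) * (b + a * a * i x)
          ≡⟨ expandʳ a b (H x) (i x) ⟩
        a * a * (H x * H x) + (b * b + (2 * b * (a * a) * (i x * 1) + a * a * (a * a) * (i x * i x)))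
          -- The square of the indicator is replaced by the indicator. The form `i x * 1` suits
          -- `∑-multiplicity` for the constant function 1.
          ≤⟨ +-monoʳ-≤ (a * a * (H x * H x)) (+-monoʳ-≤ (b * b)
               (+-monoʳ-≤ (2 * b * (a * a) * (i x * 1)) (*-monoʳ-≤ (a * a * (a * a))
                 (*-monoʳ-≤ (i x) (multiplicity≤1 _≟M_ uq x))))) ⟩
        a * a * (H x * H x) + (b * b + (2 * b * (a * a) * (i x * 1) + a * a * (a * a) * (i x * 1)))
          ≡⟨ cong (λ t → a * a * (H x * H x) + (b * b + t))
               (sym (*-distribʳ-+ (i x * 1) (2 * b * (a * a)) (a * a * (a * a)))) ⟩
        a * a * (H x * H x) + (b * b + (2 * b * (a * a) + a * a * (a * a)) * (i x * 1)) ∎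
        where
        expandˡ : ∀ a b h i → 2 * a * b * h + 2 * a * a * a * (i * h) ≡ 2 * (a * h * (b + a * a * i))
        expandˡ = solve-∀
        expandʳ : ∀ a b h i → a * h * (a * h) + (b + a * a * i) * (b + a * a * i)
          ≡ a * a * (h * h) + (b * b + (2 * b * (a * a) * (i * 1) + a * a * (a * a) * (i * i)))
        expandʳ = solve-∀

      summed : 2 * a * b * (n * (k * a)) + 2 * a * a * a * T
        ≤ a * a * S₂ + (a * a * (b * b) + (2 * b * (a * a) + a * a * (a * a)) * n)
      summed = subst₂ _≤_
        (trans (∑-+ matrices _ _) (cong₂ _+_
          (trans (∑-*ˡ matrices (2 * a * b) H) (cong (2 * a * b *_) ∑H))
          (trans (∑-*ˡ matrices (2 * a * a * a) (λ x → i x * H x))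
            (cong (2 * a * a * a *_) (∑-multiplicity _≟M_ D H matrices-unique matrices-complete)))))
        (trans (∑-+ matrices _ _) (cong₂ _+_ (∑-*ˡ matrices (a * a) (λ x → H x * H x))
          (trans (∑-+ matrices _ _) (cong₂ _+_
            (trans (∑-const matrices (b * b)) (cong (_* (b * b)) length-matrices))
            (trans (∑-*ˡ matrices (2 * b * (a * a) + a * a * (a * a)) (λ x → i x * 1)) (cong ((2 * b * (a * a) + a * a * (a * a)) *_)
              (trans (∑-multiplicity _≟M_ D (λ _ → 1) matrices-unique matrices-complete) (∑-1 D))))))))
        (∑-mono matrices pointwise)

  -- Agreeing pairs along a direction, and the energies e(c).

  pairs : List Mat → List (Mat × Mat)
  pairs D = cartesianProduct D D

  κ² : V → Mat × Mat → ℕ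
  κ² u (x , y) = κ u x y

  hits² : Mat → Mat × Mat → Mat × Mat → ℕ
  hits² c (a , a′) (d , d′) = hits c a a′ d d′

  equal : Mat × Mat → ℕ
  equal (x , y) = ⟦ x ≟M y ⟧

  agreements : List Mat → V → ℕ
  agreements D u = ∑ (pairs D) (κ² u)

  energy : Mat → List Mat → List Mat → ℕ
  energy c A D = ∑[ p ∈ pairs A ] ∑[ r ∈ pairs D ] hits² c p r

  ∑-equal : ∀ {D} → Unique D → ∑ (pairs D) equal ≤ length D
  ∑-equal {D} uq = ≤-trans (≤-reflexive (∑-cartesianProduct D D equal))
    (≤-trans (∑-mono D (multiplicity≤1 _≟M_ uq)) (≤-reflexive (∑-1 D)))

  -- For each y, only q² matrices x have u · x = u · y.
  agreements≤ : ∀ {D u} → Unique D → u ∈ directions → agreements D u ≤ q * q * length D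
  agreements≤ {D} {u} uq m = begin
    ∑ (pairs D) (κ² u)                              ≡⟨ ∑-cartesianProduct D D (κ² u) ⟩
    (∑[ x ∈ D ] ∑[ y ∈ D ] κ u x y)                 ≡⟨ ∑-swap D D (κ u) ⟩
    (∑[ y ∈ D ] ∑[ x ∈ D ] κ u x y)                 ≤⟨ ∑-mono D (λ y → ∑-⊆ _≟M_ (λ x → κ u x y) uq (λ _ → matrices-complete)) ⟩
    (∑[ y ∈ D ] ∑[ x ∈ matrices ] κ u x y)          ≡⟨ ∑-cong D (λ y → ∑-plane (u · y) (directions-nonzero m)) ⟩
    (∑[ y ∈ D ] q * q)                              ≡⟨ ∑-const D (q * q) ⟩
    length D * (q * q)                              ≡⟨ *-comm (length D) (q * q) ⟩
    q * q * length D                                ∎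
    where open ≤-Reasoning

  -- Collisions of x ↦ u · x, which takes at most q² values.
  agreements≥ : ∀ D u → length D * length D ≤ q * q * agreements D u
  agreements≥ D u = ≤-trans (collisions _≟V_ vectors-unique vectors-complete D (u ·_))
    (≤-reflexive (cong₂ _*_ length-vectors (sym (∑-cartesianProduct D D (κ² u)))))

  -- Collisions of (a, d) ↦ a c + d among the q⁴ matrices; c may be singular.
  energy≥ : ∀ c A D → length A * length D * (length A * length D) ≤ q * q * (q * q) * energy c A D
  energy≥ c A D = subst₂ _≤_ (cong (λ l → l * l) (length-× A D)) (cong₂ _*_ length-matrices reorder)
    (collisions _≟M_ matrices-unique matrices-complete (cartesianProduct A D) (λ (a , d) → (a *M c) +M d))
    where
    reorder : (∑[ x ∈ cartesianProduct A D ] ∑[ x′ ∈ cartesianProduct A D ]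
                 hits c (proj₁ x) (proj₁ x′) (proj₂ x) (proj₂ x′)) ≡ energy c A D
    reorder = trans (∑-cartesianProduct A D _) (trans (∑-cong A λ a →
        trans (∑-cong D λ d → ∑-cartesianProduct A D (λ x′ → hits c a (proj₁ x′) d (proj₂ x′)))
          (trans (∑-swap D A _) (∑-cong A λ a′ → sym (∑-cartesianProduct D D (hits² c (a , a′))))))
      (sym (∑-cartesianProduct A A _)))

  -- The energy summed over all matrices c, and over a subset of them.

  module TotalEnergy {A D : List Mat} (uqA : Unique A) (uqD : Unique D) where

    a = q * q
    k = suc q
    l = length A
    n = length D

    open SecondMoment uqD using (secondMoment; T)

    α δ : V → ℕ
    α = agreements A
    δ = agreements D

    Σα = ∑ directions α
    Σαδ = ∑[ u ∈ directions ] α u * δ u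
    S = ∑[ c ∈ matrices ] energy c A D

    ∑δ : ∑ directions δ ≡ T
    ∑δ = trans (∑-swap directions (pairs D) κ²) (∑-cartesianProduct D D _)

    -- Since α(u) ≤ a l and a δ(u) - n² ≥ 0, the sum of α(u)(a δ(u) - n²) is at most a l times the
    -- sum of a δ(u) - n², which `secondMoment` bounds by a² n. `rearrangement` expresses the
    -- pointwise step without subtraction.
    correlation : a * Σαδ ≤ n * n * Σα + a * a * a * (l * n)
    correlation = +-cancelʳ-≤ (k * (a * l * (n * n))) _ _ (begin
      a * Σαδ + k * (a * l * (n * n))
        ≡⟨ cong₂ _+_ (trans (sym (∑-*ˡ directions a _)) (∑-cong directions λ u → move a (α u) (δ u)))
             (sym (trans (∑-const directions _) (cong (_* (a * l * (n * n))) length-directions))) ⟩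
      (∑[ u ∈ directions ] α u * (a * δ u)) + (∑[ u ∈ directions ] a * l * (n * n))
        ≡⟨ ∑-+ directions _ _ ⟨
      (∑[ u ∈ directions ] (α u * (a * δ u) + a * l * (n * n)))
        ≤⟨ ∑-mono-∈ directions (λ {u} m → rearrangement (agreements≤ uqA m) (agreements≥ D u)) ⟩
      (∑[ u ∈ directions ] (α u * (n * n) + a * l * (a * δ u)))
        ≡⟨ ∑-+ directions _ _ ⟩
      (∑[ u ∈ directions ] α u * (n * n)) + (∑[ u ∈ directions ] a * l * (a * δ u))
        ≡⟨ cong₂ _+_ (trans (∑-*ʳ directions α (n * n)) (*-comm Σα (n * n)))
             (trans (∑-*ˡ directions (a * l) (λ u → a * δ u))
               (cong (a * l *_) (trans (∑-*ˡ directions a δ) (cong (a *_) ∑δ)))) ⟩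
      n * n * Σα + a * l * (a * T)
        ≤⟨ +-monoʳ-≤ (n * n * Σα) (*-monoʳ-≤ (a * l) secondMoment) ⟩
      n * n * Σα + a * l * (k * (n * n) + a * a * n)
        ≡⟨ shape a l k n Σα ⟩
      n * n * Σα + a * a * a * (l * n) + k * (a * l * (n * n)) ∎)
      where
      open ≤-Reasoning
      move : ∀ a x y → a * (x * y) ≡ x * (a * y)
      move = solve-∀
      shape : ∀ a l k n s → n * n * s + a * l * (k * (n * n) + a * a * n)
            ≡ n * n * s + a * a * a * (l * n) + k * (a * l * (n * n))
      shape = solve-∀

    -- `hits-total` summed over all quadruples: `K` gives n² `Σα`, the products of kernels give
    -- `Σαδ`, and the diagonal terms are controlled by `∑-equal`.
    summed : S + n * n * Σα ≤ l * l * (n * n) + a * Σαδ + q * (l * (n * n)) + a * a * (l * n)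
    summed = begin
      S + n * n * Σα
        ≡⟨ cong₂ _+_ swapS swapα ⟩
      (∑[ p ∈ AA ] ∑[ r ∈ DD ] ∑[ c ∈ matrices ] hits² c p r) + (∑[ p ∈ AA ] ∑[ r ∈ DD ] K² p)
        ≡⟨ trans (∑-cong AA λ p → ∑-+ DD (λ r → ∑[ c ∈ matrices ] hits² c p r) (λ _ → K² p)) (∑-+ AA _ _) ⟨
      (∑[ p ∈ AA ] ∑[ r ∈ DD ] ((∑[ c ∈ matrices ] hits² c p r) + K² p))
        ≤⟨ ∑-mono AA (λ (x , x′) → ∑-mono DD λ (y , y′) → hits-total x x′ y y′) ⟩
      (∑[ p ∈ AA ] ∑[ r ∈ DD ] (1 + a * W p r + q * equal p + a * a * (equal p * equal r)))
        ≡⟨ ∑-cong AA inner ⟩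
      (∑[ p ∈ AA ] (n * n + a * W′ p + q * (n * n) * equal p + a * a * e * equal p))
        ≡⟨ outer ⟩
      l * l * (n * n) + a * Σαδ + q * (n * n) * ∑ AA equal + a * a * e * ∑ AA equal
        ≤⟨ +-mono-≤ (+-monoʳ-≤ (l * l * (n * n) + a * Σαδ) (*-monoʳ-≤ (q * (n * n)) (∑-equal uqA)))
             (*-mono-≤ (*-monoʳ-≤ (a * a) (∑-equal uqD)) (∑-equal uqA)) ⟩
      l * l * (n * n) + a * Σαδ + q * (n * n) * l + a * a * n * l
        ≡⟨ shape a q l n (l * l * (n * n) + a * Σαδ) ⟩
      l * l * (n * n) + a * Σαδ + q * (l * (n * n)) + a * a * (l * n) ∎
      where
      open ≤-Reasoning
      AA = pairs A
      DD = pairs D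
      e = ∑ DD equal
      K² : Mat × Mat → ℕ
      K² (x , y) = K x y
      W : Mat × Mat → Mat × Mat → ℕ
      W p r = ∑[ u ∈ directions ] κ² u p * κ² u r
      W′ : Mat × Mat → ℕ
      W′ p = ∑[ u ∈ directions ] κ² u p * δ u

      swapS : S ≡ (∑[ p ∈ AA ] ∑[ r ∈ DD ] ∑[ c ∈ matrices ] hits² c p r)
      swapS = trans (∑-swap matrices AA _) (∑-cong AA λ p → ∑-swap matrices DD _)
      swapα : n * n * Σα ≡ (∑[ p ∈ AA ] ∑[ r ∈ DD ] K² p)
      swapα = sym (trans (∑-cong AA λ p → trans (∑-const DD (K² p)) (cong (_* K² p) (length-× D D)))
        (trans (∑-*ˡ AA (n * n) K²) (cong (n * n *_) (∑-swap AA directions (λ p u → κ² u p)))))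
      ∑W : ∀ p → ∑ DD (W p) ≡ W′ p
      ∑W p = trans (∑-swap DD directions _) (∑-cong directions λ u → ∑-*ˡ DD (κ² u p) (κ² u))
      ∑W′ : ∑ AA W′ ≡ Σαδ
      ∑W′ = trans (∑-swap AA directions _) (∑-cong directions λ u → ∑-*ʳ AA (κ² u) (δ u))
      ∑-four : ∀ {X : Set} (xs : List X) (f₁ f₂ f₃ f₄ : X → ℕ) →
        (∑[ x ∈ xs ] (f₁ x + f₂ x + f₃ x + f₄ x)) ≡ ∑ xs f₁ + ∑ xs f₂ + ∑ xs f₃ + ∑ xs f₄
      ∑-four xs f₁ f₂ f₃ f₄ = trans (∑-+ xs _ f₄) (cong (_+ ∑ xs f₄)
        (trans (∑-+ xs _ f₃) (cong (_+ ∑ xs f₃) (∑-+ xs f₁ f₂))))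
      regroup₁ : ∀ m q t → m * (q * t) ≡ q * m * t
      regroup₁ = solve-∀
      regroup₂ : ∀ a t s → a * (t * s) ≡ a * s * t
      regroup₂ = solve-∀
      inner : ∀ p → (∑[ r ∈ DD ] (1 + a * W p r + q * equal p + a * a * (equal p * equal r)))
            ≡ n * n + a * W′ p + q * (n * n) * equal p + a * a * e * equal p
      inner p = trans (∑-four DD (λ _ → 1) (λ r → a * W p r) (λ _ → q * equal p) _)
        (cong₂ _+_ (cong₂ _+_ (cong₂ _+_ (trans (∑-1 DD) (length-× D D))
            (trans (∑-*ˡ DD a (W p)) (cong (a *_) (∑W p))))
            (trans (∑-const DD (q * equal p)) (trans (cong (_* (q * equal p)) (length-× D D))
              (regroup₁ (n * n) q (equal p)))))
          (trans (∑-*ˡ DD (a * a) (λ r → equal p * equal r)) (trans (cong (a * a *_) (∑-*ˡ DD (equal p) equal))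
            (regroup₂ (a * a) (equal p) e))))
      outer : (∑[ p ∈ AA ] (n * n + a * W′ p + q * (n * n) * equal p + a * a * e * equal p))
            ≡ l * l * (n * n) + a * Σαδ + q * (n * n) * ∑ AA equal + a * a * e * ∑ AA equal
      outer = trans (∑-four AA (λ _ → n * n) (λ p → a * W′ p) _ _)
        (cong₂ _+_ (cong₂ _+_ (cong₂ _+_ (trans (∑-const AA (n * n)) (cong (_* (n * n)) (length-× A A)))
            (trans (∑-*ˡ AA a W′) (cong (a *_) ∑W′)))
            (∑-*ˡ AA (q * (n * n)) equal))
          (∑-*ˡ AA (a * a * e) equal))
      shape : ∀ a q l n s → s + q * (n * n) * l + a * a * n * l ≡ s + q * (l * (n * n)) + a * a * (l * n)
      shape = solve-∀

    -- The saving n² `Σα` cancels the main part of `correlation`. What is left is q⁴ times the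
    -- average (l n)²/q⁴, and three errors of size at most q⁶ l n: one from `correlation` and two
    -- from the diagonal.
    totalEnergy : S ≤ l * n * (l * n) + 3 * (a * a * a * (l * n))
    totalEnergy = +-cancelʳ-≤ (n * n * Σα) _ _ (begin
      S + n * n * Σα
        ≤⟨ summed ⟩
      l * l * (n * n) + a * Σαδ + q * (l * (n * n)) + a * a * (l * n)
        ≤⟨ +-mono-≤ (+-mono-≤ (+-monoʳ-≤ (l * l * (n * n)) correlation) third) fourth ⟩
      l * l * (n * n) + (n * n * Σα + a * a * a * (l * n)) + a * a * a * (l * n) + a * a * a * (l * n)
        ≡⟨ shape l n (a * a * a * (l * n)) (n * n * Σα) ⟩
      l * n * (l * n) + 3 * (a * a * a * (l * n)) + n * n * Σα ∎)
      where
      open ≤-Reasoning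
      shape : ∀ l n t s → l * l * (n * n) + (s + t) + t + t ≡ l * n * (l * n) + 3 * t + s
      shape = solve-∀
      move : ∀ q l n m → q * (l * (n * m)) ≡ m * q * (l * n)
      move = solve-∀
      -- One factor n is at most q⁴, and q ≤ q².
      third : q * (l * (n * n)) ≤ a * a * a * (l * n)
      third = ≤-trans (≤-reflexive (move q l n n))
        (*-monoˡ-≤ (l * n) (*-mono-≤ (length≤q⁴ uqD) (m≤m*n q q)))
      fourth : a * a * (l * n) ≤ a * a * a * (l * n)
      fourth = *-monoˡ-≤ (l * n) (m≤m*n (a * a) a)

    -- By energy≥ every matrix c contributes at least the average to the sum S, so the excess
    -- over the elements of C is at most the excess over all matrices.
    partialEnergy : ∀ {C} → Unique C →
      a * a * (∑[ c ∈ C ] energy c A D) ≤ length C * (l * n * (l * n)) + 3 * (a * a * (a * a * a) * (l * n))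
    partialEnergy {C} uqC = begin
      a * a * (∑[ c ∈ C ] energy c A D)
        ≡⟨ split C ⟩
      length C * m + ∑ C excess
        ≤⟨ +-monoʳ-≤ (length C * m) (≤-trans (∑-⊆ _≟M_ excess uqC (λ _ → matrices-complete)) total) ⟩
      length C * m + 3 * (a * a * (a * a * a) * (l * n)) ∎
      where
      open ≤-Reasoning
      m = l * n * (l * n)
      excess : Mat → ℕ
      -- No truncation occurs, by `energy≥`; hence `split` is an equality.
      excess c = a * a * energy c A D ∸ m
      split : ∀ xs → a * a * (∑[ c ∈ xs ] energy c A D) ≡ length xs * m + ∑ xs excess
      split xs = trans (sym (∑-*ˡ xs (a * a) (λ c → energy c A D)))
        (trans (∑-cong xs λ c → sym (m+[n∸m]≡n (energy≥ c A D)))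
          (trans (∑-+ xs (λ _ → m) excess) (cong (_+ ∑ xs excess) (∑-const xs m))))
      shape : ∀ a m t → a * a * (m + 3 * (a * a * a * t)) ≡ a * a * m + 3 * (a * a * (a * a * a) * t)
      shape = solve-∀
      total : ∑ matrices excess ≤ 3 * (a * a * (a * a * a) * (l * n))
      total = +-cancelˡ-≤ (a * a * m) _ _ (begin
        a * a * m + ∑ matrices excess               ≡⟨ cong (λ t → t * m + ∑ matrices excess) length-matrices ⟨
        length matrices * m + ∑ matrices excess     ≡⟨ split matrices ⟨
        a * a * S                                   ≤⟨ *-monoʳ-≤ (a * a) totalEnergy ⟩
        a * a * (m + 3 * (a * a * a * (l * n)))     ≡⟨ shape a m (l * n) ⟩
        a * a * m + 3 * (a * a * (a * a * a) * (l * n)) ∎)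

  -- From the additive energy of A and B to the energies e(c).

  *M-distribʳ : ∀ x y c → (x +M y) *M c ≡ (x *M c) +M (y *M c)
  *M-distribʳ x y c = mat-cong
      (entry (m11 x) (m12 x) (m11 y) (m12 y) (m11 c) (m21 c))
      (entry (m11 x) (m12 x) (m11 y) (m12 y) (m12 c) (m22 c))
      (entry (m21 x) (m22 x) (m21 y) (m22 y) (m11 c) (m21 c))
      (entry (m21 x) (m22 x) (m21 y) (m22 y) (m12 c) (m22 c))
    where
    entry : ∀ x₁ x₂ y₁ y₂ c₁ c₂ → (x₁ ⊕ y₁) ⊗ c₁ ⊕ (x₂ ⊕ y₂) ⊗ c₂
          ≡ (x₁ ⊗ c₁ ⊕ x₂ ⊗ c₂) ⊕ (y₁ ⊗ c₁ ⊕ y₂ ⊗ c₂)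
    entry = solve 6 (λ x₁ x₂ y₁ y₂ c₁ c₂ → (x₁ :+ y₁) :* c₁ :+ (x₂ :+ y₂) :* c₂
          := (x₁ :* c₁ :+ x₂ :* c₂) :+ (y₁ :* c₁ :+ y₂ :* c₂)) refl

  *M-cancelʳ : ∀ {x y} c → Invertible c → x *M c ≡ y *M c → x ≡ y
  *M-cancelʳ {x} {y} c inv e = cong₂ fromRows
    (sameRow (row₁ x) (row₁ y) (cong m11 e) (cong m12 e))
    (sameRow (row₂ x) (row₂ y) (cong m21 e) (cong m22 e))
    where
    ind : Independent (col₁ c) (col₂ c)
    ind h = inv (trans (cong (_⊕ ⊖ (m12 c ⊗ m21 c)) (trans h (R.*-comm _ _))) (R.-‿inverseʳ _))
    sameRow : ∀ r s → dot r (col₁ c) ≡ dot s (col₁ c) → dot r (col₂ c) ≡ dot s (col₂ c) → r ≡ s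
    sameRow r s e₁ e₂ = independent-injective ind
      (trans (dot-comm (col₁ c) r) (trans e₁ (dot-comm s (col₁ c))))
      (trans (dot-comm (col₂ c) r) (trans e₂ (dot-comm s (col₂ c))))

  -- Multiplying a + b = a′ + b′ on the right by c gives a solution with d = b c and d′ = b′ c. As c
  -- is invertible, b ↦ b c embeds B into D.
  E+≤energy : ∀ {A B D c} → Unique B → Invertible c → (∀ {b} → b ∈ B → b *M c ∈ D) →
              E+ A B ≤ energy c A D
  E+≤energy {A} {B} {D} {c} uqB inv B·c⊆D = begin
    E+ A B
      ≡⟨ trans (length-filter _ (cartesianProduct (pairs A) (pairs B))) (∑-cartesianProduct (pairs A) (pairs B) _) ⟩
    (∑[ p ∈ pairs A ] ∑[ r ∈ pairs B ] sums p r)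
      ≤⟨ ∑-mono (pairs A) translate ⟩
    energy c A D ∎
    where
    open ≤-Reasoning
    sums : Mat × Mat → Mat × Mat → ℕ
    sums (a , a′) (b , b′) = ⟦ (a +M b) ≟M (a′ +M b′) ⟧

    transport : (f : Mat → ℕ) → (∑[ b ∈ B ] f (b *M c)) ≤ ∑ D f
    transport f = ≤-trans (≤-reflexive (sym (∑-map (_*M c) B f)))
      (∑-⊆ _≟M_ f (map⁺ (*M-cancelʳ c inv) uqB) sub)
      where
      sub : ∀ {x} → x ∈ map (_*M c) B → x ∈ D
      sub m with ∈-map⁻ (_*M c) m
      ... | _ , b∈B , refl = B·c⊆D b∈B

    multiply : ∀ a a′ b b′ → ⟦ (a +M b) ≟M (a′ +M b′) ⟧ ≤ hits c a a′ (b *M c) (b′ *M c)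
    multiply a a′ b b′ = ⟦⟧-mono _ _ λ e →
      trans (sym (*M-distribʳ a b c)) (trans (cong (_*M c) e) (*M-distribʳ a′ b′ c))

    translate : ∀ p → ∑ (pairs B) (sums p) ≤ ∑ (pairs D) (hits² c p)
    translate p@(a , a′) = begin
      ∑ (pairs B) (sums p)
        ≡⟨ ∑-cartesianProduct B B (sums p) ⟩
      (∑[ b ∈ B ] ∑[ b′ ∈ B ] sums p (b , b′))
        ≤⟨ ∑-mono B (λ b → ∑-mono B λ b′ → multiply a a′ b b′) ⟩
      (∑[ b ∈ B ] ∑[ b′ ∈ B ] hits c a a′ (b *M c) (b′ *M c))
        -- The embedding is applied to b′ for fixed b, and then to b.
        ≤⟨ ∑-mono B (λ b → transport (λ d′ → hits c a a′ (b *M c) d′)) ⟩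
      (∑[ b ∈ B ] ∑[ d′ ∈ D ] hits c a a′ (b *M c) d′)
        ≤⟨ transport (λ d → ∑[ d′ ∈ D ] hits c a a′ d d′) ⟩
      (∑[ d ∈ D ] ∑[ d′ ∈ D ] hits c a a′ d d′)
        ≡⟨ ∑-cartesianProduct D D (hits² c p) ⟨
      ∑ (pairs D) (hits² c p) ∎

  -- `E+≤energy` is summed over c ∈ C with D = BC, and `partialEnergy` bounds the result.
  energyBound : ∀ {A B C} → Unique A → Unique B → Unique C → All Invertible C →
    let m = length A * length (prodSet B C) in
    q * q * (q * q) * (length C * E+ A B)
      ≤ length C * (m * m) + 3 * (q * q * (q * q) * (q * q * (q * q) * (q * q)) * m)
  energyBound {A} {B} {C} uqA uqB uqC inv =
    ≤-trans (*-monoʳ-≤ (q * q * (q * q)) (≤-trans (≤-reflexive (sym (∑-const C (E+ A B))))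
        (∑-mono-∈ C λ c∈C → E+≤energy {A} uqB (All.lookup inv c∈C)
          (λ b∈B → ∈-deduplicate⁺ _≟M_ (∈-cartesianProductWith⁺ _*M_ b∈B c∈C)))))
      (TotalEnergy.partialEnergy uqA (DecUnique.deduplicate-! _≟M_ (cartesianProductWith _*M_ B C)) uqC)

-- The cross term 6uv is at most 3u² + 3v², which gives 4u² + 12v².
square-bound : ∀ {x u v} → x ≤ u + 3 * v → x * x ≤ 12 * (u * u + v * v)
square-bound {x} {u} {v} x≤ = begin
  x * x                                             ≤⟨ *-mono-≤ x≤ x≤ ⟩
  (u + 3 * v) * (u + 3 * v)                         ≡⟨ expand u v ⟩
  u * u + 9 * (v * v) + 3 * (2 * (u * v))           ≤⟨ +-monoʳ-≤ (u * u + 9 * (v * v)) (*-monoʳ-≤ 3 (2xy≤x²+y² u v)) ⟩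
  u * u + 9 * (v * v) + 3 * (u * u + v * v)         ≤⟨ m≤m+n _ (8 * (u * u)) ⟩
  u * u + 9 * (v * v) + 3 * (u * u + v * v) + 8 * (u * u) ≡⟨ collect (u * u) (v * v) ⟩
  12 * (u * u + v * v)                              ∎
  where
  open ≤-Reasoning
  expand : ∀ u v → (u + 3 * v) * (u + 3 * v) ≡ u * u + 9 * (v * v) + 3 * (2 * (u * v))
  expand = solve-∀
  collect : ∀ s t → s + 9 * t + 3 * (s + t) + 8 * s ≡ 12 * (s + t)
  collect = solve-∀

-- The inequality is multiplied by q⁴|C| and squared, which turns the exponent 13/2 into 21. Since
-- (X + Y)² and X² + Y² agree up to a factor 2, this is equivalent up to the constant.
theorem2p2 : ∃ λ (c : ℕ) → (F : FiniteField) → IsPrimePower (FiniteField.card F) →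
    (A B C : List (M2.Mat F)) → Unique A → Unique B → Unique C →
    All (M2.Invertible F) C → C ≢ [] →
    (M2.E+ F A B) ^ 2 * (FiniteField.card F) ^ 8 * (length C) ^ 2
    ≤ c * ((length A) ^ 4 * (length (M2.prodSet F B C)) ^ 4 * (length C) ^ 2
    + (FiniteField.card F) ^ 21 * (length A) ^ 2 * (length (M2.prodSet F B C)) ^ 2)
theorem2p2 = 12 , λ F _ A B C uqA uqB uqC inv _ →
  let open Plane F using (q; q-nonZero; energyBound)
      l = length A
      n = length (M2.prodSet F B C)
      w = length C
  in begin
  (M2.E+ F A B) ^ 2 * q ^ 8 * w ^ 2
    ≡⟨ lhs (M2.E+ F A B) q w ⟩
  q * q * (q * q) * (w * M2.E+ F A B) * (q * q * (q * q) * (w * M2.E+ F A B))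
    ≤⟨ square-bound {u = w * (l * n * (l * n))} {V q l n} (energyBound uqA uqB uqC inv) ⟩
  12 * (w * (l * n * (l * n)) * (w * (l * n * (l * n))) + V q l n * V q l n)
    -- The square of `V` has only q²⁰; as q ≥ 1, a further factor q may be inserted.
    ≤⟨ *-monoʳ-≤ 12 (+-mono-≤ (≤-reflexive (first w l n)) (≤-trans
         (m≤m*n (V q l n * V q l n) q ⦃ q-nonZero ⦄) (≤-reflexive (second q l n)))) ⟩
  12 * (l ^ 4 * n ^ 4 * w ^ 2 + q ^ 21 * l ^ 2 * n ^ 2) ∎
  where
  open ≤-Reasoning
  open +-*-Solver using (_:^_; _:*_; _:=_)
  V : ℕ → ℕ → ℕ → ℕ
  V q l n = q * q * (q * q) * (q * q * (q * q) * (q * q)) * (l * n)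
  lhs : ∀ e q w → e ^ 2 * q ^ 8 * w ^ 2 ≡ q * q * (q * q) * (w * e) * (q * q * (q * q) * (w * e))
  lhs = +-*-Solver.solve 3 (λ e q w → e :^ 2 :* q :^ 8 :* w :^ 2
    := q :* q :* (q :* q) :* (w :* e) :* (q :* q :* (q :* q) :* (w :* e))) refl
  first : ∀ w l n → w * (l * n * (l * n)) * (w * (l * n * (l * n))) ≡ l ^ 4 * n ^ 4 * w ^ 2
  first = +-*-Solver.solve 3 (λ w l n → w :* (l :* n :* (l :* n)) :* (w :* (l :* n :* (l :* n)))
    := l :^ 4 :* n :^ 4 :* w :^ 2) refl
  second : ∀ q l n → q * q * (q * q) * (q * q * (q * q) * (q * q)) * (l * n)
      * (q * q * (q * q) * (q * q * (q * q) * (q * q)) * (l * n)) * q ≡ q ^ 21 * l ^ 2 * n ^ 2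
  second = +-*-Solver.solve 3 (λ q l n → q :* q :* (q :* q) :* (q :* q :* (q :* q) :* (q :* q)) :* (l :* n)
      :* (q :* q :* (q :* q) :* (q :* q :* (q :* q) :* (q :* q)) :* (l :* n)) :* q
    := q :^ 21 :* l :^ 2 :* n :^ 2) refl
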